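{- Let $m\ge 3$ and $n\ge 3$. Kemeny's constant of the complete flower graph $F_n(K_m)$ is $$\mathscr K(F_n(K_m))=\frac{(m-1)\left(-12n+m(n^2+6n-1)\right)}{6m}.$$
   Context: For a connected graph $H$ with vertex set $\{1,\dots,N\}$ and Laplacian matrix $L$, the resistance distance between vertices $i,j$ is $r_H(i,j)=(e_i-e_j)^T L^\dagger (e_i-e_j)$, where $e_i$ is the $i$th standard unit vector and $L^\dagger$ is the Moore–Penrose pseudoinverse of $L$. Kemeny's constant of (the simple random walk on) a connected graph $H$ is given by $\mathscr K(H)=\frac{1}{4|E(H)|}\sum_{i,j\in V(H)} d_i d_j\, r_H(i,j)$, where $d_i$ is the degree of $i$ in $H$ and the sum is over ordered pairs; this formula may be taken as the definition. Complete flower graph: for $m\ge3$, $n\ge 3$, fix two distinct vertices $x,y$ of the complete graph $K_m$ (the choice is irrelevant up to isomorphism). $F_n(K_m)$ is obtained from $n$ vertex-disjoint copies $G_1,\dots,G_n$ of $K_m$, with $x_i,y_i$ the copies of $x,y$ in $G_i$, by identifying $y_i$ with $x_{i+1}$ for $1\le i<n$ and $y_n$ with $x_1$. -}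

module Defs where

open import Algebra.Bundles using (CommutativeRing)
open import Data.Bool.Base using (if_then_else_)
open import Data.Empty using (⊥-elim)
open import Data.Fin.Base using (Fin; toℕ; combine; remQuot; punchIn; punchOut)
open import Data.Fin.Properties
  using (_≟_; _<?_; any?; toℕ<n; toℕ-fromℕ<; combine-injective; remQuot-combine; combine-remQuot; punchInᵢ≢i;
         punchOut-injective; punchIn-punchOut; punchOut-punchIn; punchOut-cong)
open import Data.Integer.Base using (+_)
open import Data.Nat.Base as ℕ using (ℕ; suc; pred; s≤s; NonZero)
import Data.Nat.DivMod as ℕ
import Data.Nat.Properties as ℕ
open import Data.Product.Base using (∃; _×_; _,_; proj₁; proj₂)
open import Data.Rational.Base as ℚ using (ℚ; _/_)
import Data.Rational.Properties as ℚ
open import Function.Base using (_∘_)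
open import Function.Bundles using (_⇔_; mk⇔)
open import Level using (0ℓ)
open import Relation.Binary.Core using (Rel)
open import Relation.Binary.Definitions using (Decidable; Symmetric)
open import Relation.Binary.PropositionalEquality
  using (_≡_; _≢_; refl; sym; trans; cong; cong₂; subst; isEquivalence; module ≡-Reasoning)
open import Relation.Binary.Construct.Closure.Equivalence as EqC using (EqClosure)
open import Relation.Binary.Construct.Closure.ReflexiveTransitive using (Star)
open import Relation.Nullary using (¬_; Dec; yes; no; does)
open import Relation.Nullary.Decidable using (_×-dec_; ¬?)

import Algebra.Properties.Semiring.Sum as SemiringSum

module ∑ℕ = SemiringSum ℕ.+-*-semiring
module ∑ℚ = SemiringSum (CommutativeRing.semiring ℚ.+-*-commutativeRing)

Mat : ℕ → Set
Mat N = Fin N → Fin N → ℚ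

infix  4 _≋_
infixl 7 _⊗_
infix  8 _ᵀ

_≋_ : ∀ {N} → Mat N → Mat N → Set
A ≋ B = ∀ i j → A i j ≡ B i j

_⊗_ : ∀ {N} → Mat N → Mat N → Mat N
_⊗_ {N} A B i j = ∑[ k < N ] (A i k ℚ.* B k j)
  where open ∑ℚ

_ᵀ : ∀ {N} → Mat N → Mat N
(A ᵀ) i j = A j i

-- The four Penrose conditions. The real pseudoinverse of a rational matrix
-- has rational entries, so working over ℚ loses nothing.
record IsPseudoinverse {N} (A A† : Mat N) : Set where
  field
    AA†A≋A   : A ⊗ A† ⊗ A ≋ A
    A†AA†≋A† : A† ⊗ A ⊗ A† ≋ A†
    AA†-sym  : (A ⊗ A†) ᵀ ≋ A ⊗ A†
    A†A-sym  : (A† ⊗ A) ᵀ ≋ A† ⊗ A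

record Graph (N : ℕ) : Set₁ where
  field
    Adj       : Rel (Fin N) 0ℓ
    adj?      : Decidable Adj
    adj-sym   : Symmetric Adj
    adj-irrefl : ∀ {u} → ¬ Adj u u

𝟙 : ∀ {a} {A : Set a} → Dec A → ℕ
𝟙 A? = if does A? then 1 else 0

fromℕ : ℕ → ℚ
fromℕ n = + n / 1

module _ {N} (H : Graph N) where
  open Graph H

  Connected : Set
  Connected = ∀ u v → Star Adj u v

  degree : Fin N → ℕ
  degree u = ∑[ v < N ] 𝟙 (adj? u v)
    where open ∑ℕ

  -- Each edge {u , v} is counted once, as the pair with u < v.
  edgeCount : ℕ
  edgeCount = ∑[ u < N ] ∑[ v < N ] 𝟙 ((u <? v) ×-dec adj? u v)
    where open ∑ℕ

  laplacian : Mat N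
  laplacian i j = fromℕ (degree i ℕ.* 𝟙 (i ≟ j)) ℚ.- fromℕ (𝟙 (adj? i j))

unit : ∀ {N} → Fin N → Fin N → ℚ
unit i k = fromℕ (𝟙 (i ≟ k))

-- (eᵢ - eⱼ)ᵀ L† (eᵢ - eⱼ)
resistance : ∀ {N} → Mat N → Fin N → Fin N → ℚ
resistance {N} L† i j =
  ∑[ a < N ] ∑[ b < N ] ((unit i a ℚ.- unit j a) ℚ.* L† a b ℚ.* (unit i b ℚ.- unit j b))
  where open ∑ℚ

weightedResistanceSum : ∀ {N} → Graph N → Mat N → ℚ
weightedResistanceSum {N} H L† =
  ∑[ i < N ] ∑[ j < N ] (fromℕ (degree H i) ℚ.* fromℕ (degree H j) ℚ.* resistance L† i j)
  where open ∑ℚ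

-- "Kemeny's constant of H is k". Kemeny's constant is only defined for a
-- connected graph with at least one edge; the pseudoinverse is determined by
-- the Laplacian, so k is determined by H (see kemeny-unique).
record IsKemenyConstant {N} (H : Graph N) (k : ℚ) : Set where
  field
    connected   : Connected H
    4∣E∣≢0      : NonZero (4 ℕ.* edgeCount H)
    L†          : Mat N
    isPseudoinverse : IsPseudoinverse (laplacian H) L†
    value       : k ≡ (+ 1 / (4 ℕ.* edgeCount H)) {{4∣E∣≢0}} ℚ.* weightedResistanceSum H L†

complete : ∀ m → Graph m
complete m = record
  { Adj        = _≢_
  ; adj?       = λ u v → ¬? (u ≟ v)
  ; adj-sym    = λ u≢v → u≢v ∘ sym
  ; adj-irrefl = λ u≢u → u≢u refl
  }

-- The cyclic successor i ↦ i + 1 mod n.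
next : ∀ {n} → Fin n → Fin n
next {suc n} i = suc (toℕ i) ℕ.mod suc n

-- The identification of yᵢ with xᵢ₊₁ (indices mod n); (i , v) is the copy of
-- v in Gᵢ.
data Identified {n m} (x y : Fin m) : Rel (Fin n × Fin m) 0ℓ where
  identify : ∀ i → Identified x y (i , y) (next i , x)

-- The quotient map onto the vertices of the flower. Each class has exactly one
-- representative (i , v) with v ≢ y, and it is numbered by i together with the
-- position of v among the vertices other than y. See glue-surjective and
-- glue-≡⇔ for the proof that this is the quotient by Identified.
glue : ∀ {n m} {x y : Fin m} → x ≢ y → Fin n × Fin m → Fin (n ℕ.* pred m)
glue {m = suc _} {x} {y} x≢y (i , v) with y ≟ v
... | yes _   = combine (next i) (punchOut (x≢y ∘ sym))
... | no  y≢v = combine i (punchOut y≢v)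

next-≢ : ∀ {n} → 2 ℕ.≤ n → (i : Fin n) → next i ≢ i
next-≢ {suc n} 2≤n i eq with suc (toℕ i) ℕ.≟ suc n | trans (sym (toℕ-fromℕ< _)) (cong toℕ eq)
... | no  si≢n | p = ℕ.1+n≢n (trans (sym (ℕ.m<n⇒m%n≡m (ℕ.≤∧≢⇒< (toℕ<n i) si≢n))) p)
... | yes si≡n | p = ℕ.<⇒≢ 2≤n (trans (cong suc 0≡i) si≡n)
  where
  0≡i : 0 ≡ toℕ i
  0≡i = trans (sym (trans (cong (ℕ._% suc n) si≡n) (ℕ.n%n≡0 (suc n)))) p

glue-injective-in-copy : ∀ {n m} {x y : Fin m} (x≢y : x ≢ y) → 2 ℕ.≤ n → (i : Fin n) →
                         ∀ {a b} → glue x≢y (i , a) ≡ glue x≢y (i , b) → a ≡ b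
glue-injective-in-copy {m = suc _} {x} {y} x≢y 2≤n i {a} {b} eq with y ≟ a | y ≟ b
... | yes y≡a | yes y≡b = trans (sym y≡a) y≡b
... | yes _   | no  _   = ⊥-elim (next-≢ 2≤n i (proj₁ (combine-injective _ _ _ _ eq)))
... | no  _   | yes _   = ⊥-elim (next-≢ 2≤n i (sym (proj₁ (combine-injective _ _ _ _ eq))))
... | no  y≢a | no  y≢b = punchOut-injective y≢a y≢b (proj₂ (combine-injective i _ i _ eq))

-- F_n(G): two vertices of the quotient are adjacent iff some copy of G has an
-- edge between representatives of them.
flower : ∀ {n m} → 3 ℕ.≤ n → Graph m → {x y : Fin m} → x ≢ y → Graph (n ℕ.* pred m)
flower {n} {m} 3≤n G x≢y = record
  { Adj        = λ u w → ∃ λ i → ∃ λ a → ∃ λ b →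
                   Adj a b × glue {n} x≢y (i , a) ≡ u × glue x≢y (i , b) ≡ w
  ; adj?       = λ u w → any? λ i → any? λ a → any? λ b →
                   adj? a b ×-dec (glue x≢y (i , a) ≟ u) ×-dec (glue x≢y (i , b) ≟ w)
  ; adj-sym    = λ (i , a , b , ab , p , q) → i , b , a , adj-sym ab , q , p
  ; adj-irrefl = irrefl
  }
  where
  open Graph G
  irrefl : ∀ {u} → ¬ (∃ λ i → ∃ λ a → ∃ λ b →
             Adj a b × glue {n} x≢y (i , a) ≡ u × glue x≢y (i , b) ≡ u)
  irrefl (i , a , b , ab , p , q)
    with refl ← glue-injective-in-copy x≢y (ℕ.≤-trans (ℕ.n≤1+n 2) 3≤n) i (trans p (sym q))
    = adj-irrefl ab

section : ∀ {n m} → Fin m → Fin (n ℕ.* pred m) → Fin n × Fin m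
section {n} {suc k} y u = proj₁ (remQuot {n} k u) , punchIn y (proj₂ (remQuot {n} k u))

section-combine : ∀ {n k} (y : Fin (suc k)) (i : Fin n) (j : Fin k) →
                  section {n} y (combine i j) ≡ (i , punchIn y j)
section-combine y i j = cong (λ p → proj₁ p , punchIn y (proj₂ p)) (remQuot-combine i j)

glue-section : ∀ {n m} {x y : Fin m} (x≢y : x ≢ y) (u : Fin (n ℕ.* pred m)) →
               glue {n} x≢y (section y u) ≡ u
glue-section {n} {suc k} {x} {y} x≢y u with y ≟ punchIn y (proj₂ (remQuot {n} k u))
... | yes y≡ = ⊥-elim (punchInᵢ≢i y _ (sym y≡))
... | no  y≢ = trans (cong (combine (proj₁ (remQuot {n} k u)))
                       (trans (punchOut-cong y refl) (punchOut-punchIn y)))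
                     (combine-remQuot {n} k u)

glue-surjective : ∀ {n m} {x y : Fin m} (x≢y : x ≢ y) (u : Fin (n ℕ.* pred m)) →
                  ∃ λ p → glue {n} x≢y p ≡ u
glue-surjective {n} {y = y} x≢y u = section {n} y u , glue-section {n} x≢y u

glue-identified : ∀ {n m} {x y : Fin m} (x≢y : x ≢ y) {p q : Fin n × Fin m} →
                  Identified x y p q → glue x≢y p ≡ glue x≢y q
glue-identified {m = suc _} {x} {y} x≢y (identify i) with y ≟ y | y ≟ x
... | no y≢y | _       = ⊥-elim (y≢y refl)
... | yes _  | yes y≡x = ⊥-elim (x≢y (sym y≡x))
... | yes _  | no  _   = cong (combine (next i)) (punchOut-cong y refl)

section-glue : ∀ {n m} {x y : Fin m} (x≢y : x ≢ y) (p : Fin n × Fin m) →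
               EqClosure (Identified x y) p (section y (glue x≢y p))
section-glue {n} {suc _} {x} {y} x≢y (i , v) with y ≟ v
... | yes refl = subst (EqClosure (Identified x y) (i , y))
                   (sym (trans (section-combine y (next i) _)
                               (cong (next i ,_) (punchIn-punchOut (x≢y ∘ sym)))))
                   (EqC.return (identify i))
... | no y≢v   = subst (EqClosure (Identified x y) (i , v))
                   (sym (trans (section-combine y i _) (cong (i ,_) (punchIn-punchOut y≢v))))
                   (EqC.reflexive (Identified x y))

glue-≡⇔ : ∀ {n m} {x y : Fin m} (x≢y : x ≢ y) (p q : Fin n × Fin m) →
          (glue x≢y p ≡ glue x≢y q) ⇔ EqClosure (Identified x y) p q
glue-≡⇔ {x = x} {y} x≢y p q = mk⇔
  (λ eq → EqC.transitive R
            (subst (EqClosure R p ∘ section y) eq (section-glue x≢y p))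
            (EqC.symmetric R (section-glue x≢y q)))
  (EqC.gfold isEquivalence (glue x≢y) (glue-identified x≢y))
  where R = Identified x y

≋-sym : ∀ {N} {A B : Mat N} → A ≋ B → B ≋ A
≋-sym e i j = sym (e i j)

≋-trans : ∀ {N} {A B C : Mat N} → A ≋ B → B ≋ C → A ≋ C
≋-trans e f i j = trans (e i j) (f i j)

⊗-cong : ∀ {N} {A A′ B B′ : Mat N} → A ≋ A′ → B ≋ B′ → A ⊗ B ≋ A′ ⊗ B′
⊗-cong e f i j = ∑ℚ.sum-cong-≗ (λ k → cong₂ ℚ._*_ (e i k) (f k j))

⊗-congˡ : ∀ {N} (A : Mat N) {B B′ : Mat N} → B ≋ B′ → A ⊗ B ≋ A ⊗ B′
⊗-congˡ A = ⊗-cong {A = A} (λ _ _ → refl)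

⊗-congʳ : ∀ {N} {A A′ : Mat N} (B : Mat N) → A ≋ A′ → A ⊗ B ≋ A′ ⊗ B
⊗-congʳ B e = ⊗-cong {B = B} e (λ _ _ → refl)

⊗-assoc : ∀ {N} (A B C : Mat N) → A ⊗ B ⊗ C ≋ A ⊗ (B ⊗ C)
⊗-assoc {N} A B C i j = begin
  ∑[ k < N ] (∑[ l < N ] (A i l ℚ.* B l k) ℚ.* C k j)
    ≡⟨ sum-cong-≗ (λ k → *-distribʳ-sum (C k j) (λ l → A i l ℚ.* B l k)) ⟩
  ∑[ k < N ] ∑[ l < N ] (A i l ℚ.* B l k ℚ.* C k j)
    ≡⟨ ∑-comm (λ k l → A i l ℚ.* B l k ℚ.* C k j) ⟩
  ∑[ l < N ] ∑[ k < N ] (A i l ℚ.* B l k ℚ.* C k j)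
    ≡⟨ sum-cong-≗ (λ l → trans
         (sum-cong-≗ (λ k → ℚ.*-assoc (A i l) (B l k) (C k j)))
         (sym (*-distribˡ-sum (A i l) (λ k → B l k ℚ.* C k j)))) ⟩
  ∑[ l < N ] (A i l ℚ.* (∑[ k < N ] (B l k ℚ.* C k j))) ∎
  where
  open ∑ℚ
  open ≡-Reasoning

⊗-ᵀ : ∀ {N} (A B : Mat N) → (A ⊗ B) ᵀ ≋ B ᵀ ⊗ A ᵀ
⊗-ᵀ A B i j = ∑ℚ.sum-cong-≗ (λ k → ℚ.*-comm (A j k) (B k i))

-- If S and T are symmetric, S T ≋ T and T S ≋ S, then S ≋ T.
symmetric-absorb : ∀ {N} (S T : Mat N) → S ᵀ ≋ S → T ᵀ ≋ T →
                   S ⊗ T ≋ T → T ⊗ S ≋ S → S ≋ T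
symmetric-absorb S T Sᵀ Tᵀ ST TS i j = begin
  S i j           ≡⟨ Sᵀ i j ⟨
  S j i           ≡⟨ TS j i ⟨
  (T ⊗ S) j i     ≡⟨ ⊗-ᵀ T S i j ⟩
  (S ᵀ ⊗ T ᵀ) i j ≡⟨ ⊗-cong Sᵀ Tᵀ i j ⟩
  (S ⊗ T) i j     ≡⟨ ST i j ⟩
  T i j           ∎
  where open ≡-Reasoning

pseudoinverse-unique : ∀ {N} {A P Q : Mat N} →
                       IsPseudoinverse A P → IsPseudoinverse A Q → P ≋ Q
pseudoinverse-unique {A = A} {P} {Q} p q =
  ≋-trans (≋-sym P.A†AA†≋A†)
  (≋-trans (⊗-congʳ P PA≋QA)
  (≋-trans (⊗-assoc Q A P)
  (≋-trans (⊗-congˡ Q AP≋AQ)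
  (≋-trans (≋-sym (⊗-assoc Q A Q)) Q.A†AA†≋A†))))
  where
  module P = IsPseudoinverse p
  module Q = IsPseudoinverse q

  AP≋AQ : A ⊗ P ≋ A ⊗ Q
  AP≋AQ = symmetric-absorb (A ⊗ P) (A ⊗ Q) P.AA†-sym Q.AA†-sym
    (≋-trans (≋-sym (⊗-assoc (A ⊗ P) A Q)) (⊗-congʳ Q P.AA†A≋A))
    (≋-trans (≋-sym (⊗-assoc (A ⊗ Q) A P)) (⊗-congʳ P Q.AA†A≋A))

  absorb : ∀ R R′ → A ⊗ R′ ⊗ A ≋ A → R ⊗ A ⊗ (R′ ⊗ A) ≋ R ⊗ A
  absorb R R′ e =
    ≋-trans (⊗-assoc R A (R′ ⊗ A)) (⊗-congˡ R (≋-trans (≋-sym (⊗-assoc A R′ A)) e))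

  PA≋QA : P ⊗ A ≋ Q ⊗ A
  PA≋QA = ≋-sym (λ i j → begin
    (Q ⊗ A) i j                   ≡⟨ Q.A†A-sym i j ⟨
    (Q ⊗ A) j i                   ≡⟨ absorb Q P P.AA†A≋A j i ⟨
    (Q ⊗ A ⊗ (P ⊗ A)) j i         ≡⟨ ⊗-ᵀ (Q ⊗ A) (P ⊗ A) i j ⟩
    ((P ⊗ A) ᵀ ⊗ (Q ⊗ A) ᵀ) i j   ≡⟨ ⊗-cong P.A†A-sym Q.A†A-sym i j ⟩
    (P ⊗ A ⊗ (Q ⊗ A)) i j         ≡⟨ absorb P Q Q.AA†A≋A i j ⟩
    (P ⊗ A) i j                   ∎)
    where open ≡-Reasoning

weightedResistanceSum-cong : ∀ {N} (H : Graph N) {P Q : Mat N} → P ≋ Q →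
                             weightedResistanceSum H P ≡ weightedResistanceSum H Q
weightedResistanceSum-cong {N} H {P} {Q} e =
  sum-cong-≗ {N} λ i → sum-cong-≗ {N} λ j →
    cong (fromℕ (degree H i) ℚ.* fromℕ (degree H j) ℚ.*_)
      (sum-cong-≗ {N} λ a → sum-cong-≗ {N} λ b →
        cong (λ z → (unit i a ℚ.- unit j a) ℚ.* z ℚ.* (unit i b ℚ.- unit j b)) (e a b))
  where open ∑ℚ

kemeny-unique : ∀ {N} {H : Graph N} {k k′ : ℚ} →
                IsKemenyConstant H k → IsKemenyConstant H k′ → k ≡ k′
kemeny-unique {H = H} p q = trans P.value (trans
  (cong ((+ 1 / (4 ℕ.* edgeCount H)) {{P.4∣E∣≢0}} ℚ.*_)
    (weightedResistanceSum-cong H (pseudoinverse-unique P.isPseudoinverse Q.isPseudoinverse)))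
  (sym Q.value))
  where
  module P = IsKemenyConstant p
  module Q = IsKemenyConstant q

6m≢0 : ∀ {m} → 3 ℕ.≤ m → NonZero (6 ℕ.* m)
6m≢0 (s≤s _) = _

{-# OPTIONS --safe #-}

-- Inside a flower each copy of K_m acts between its two hubs as a resistor 2/m, so Kirchhoff's
-- equations reduce to those of a weighted n-cycle, whose Green function is quadratic in the
-- distance. This yields an explicit symmetric Z with L Z = 4mn I - w 1ᵀ, and hence the
-- pseudoinverse, with r(i,j) = (Z i i + Z j j - 2 Z i j) / 4mn. A vertex of degree d lies in
-- d / (m - 1) copies, so every degree-weighted sum over the vertices is m - 1 times a sum over the
-- copies; with this, Kemeny's constant (∑ d_i Z i i - ∑ d_i d_j Z i j / 2∣E∣) / 4mn is evaluated.
module Submission where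

open import Defs

-- In a copy with potential f and total S, the current entering at a vertex a is m f(a) - S. It
-- vanishes at an inner vertex without source, so f = S / m there; hence S = m (f(x) + f(y)) / 2,
-- and the current at x is (m / 2)(f(x) - f(y)): this is the resistor 2 / m. On the cycle of n such
-- resistors, a unit source at distance d has potential -d (n - d) / (mn) up to a constant. Inner
-- vertices average over two hubs, both as source and as observer, whence the 4 in 4mn. A single
-- source on a finite graph has to be drained. Any drain w that does not depend on the source will
-- do, since a term constant along each row disappears under double centring. Draining equally at
-- all hubs keeps the problem on the cycle invariant under rotation. The obstacle is that adjacency
-- in the quotient is an existential over copies. The Laplacian is the sum of the Laplacians of the
-- copies only if every edge comes from a single copy, and this is where n ≥ 3 enters: on a cycle of
-- length 2 the two copies would share both hubs.

module KemenyOfFlower where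

  open import Data.Empty using (⊥-elim)
  open import Data.Fin.Base as Fin using (Fin; zero; suc; toℕ; inject₁; combine; remQuot; punchIn; punchOut)
  open import Data.Fin.Induction using (<-weakInduction)
  import Data.Fin.Properties as Fin
  open import Data.Fin.Properties using (_≟_; _<?_; any?)
  open import Data.Fin.Relation.Unary.Top using (view; ‵fromℕ; ‵inject₁)
  open import Data.Integer.Base as ℤ using (ℤ)
  import Data.Integer.Properties as ℤ
  open import Data.Maybe.Base using (Maybe; just; nothing)
  open import Data.Nat.Base as ℕ using (ℕ; zero; suc; NonZero; ∣_-_∣)
  import Data.Nat.DivMod as ℕ
  import Data.Nat.Properties as ℕ
  open import Data.Product.Base using (∃; _×_; _,_; proj₁; proj₂)
  open import Data.Rational.Base as ℚ using (ℚ; 0ℚ; 1ℚ; toℚᵘ; _+_; _*_; _-_)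
  import Data.Rational.Properties as ℚ
  open import Data.Rational.Unnormalised.Base as ℚᵘ using (mkℚᵘ; _≃_; *≡*)
  import Data.Rational.Unnormalised.Properties as ℚᵘ
  open import Data.Sum.Base using (_⊎_; inj₁; inj₂)
  open import Function.Base using (_∘_)
  open import Relation.Binary.Construct.Closure.ReflexiveTransitive as Star using (Star; ε; _◅_; _◅◅_)
  open import Relation.Binary.Definitions using (tri<; tri≈; tri>)
  open import Relation.Binary.PropositionalEquality
    using (_≡_; _≢_; refl; sym; trans; cong; cong₂; subst; subst₂; module ≡-Reasoning)
  open import Relation.Nullary using (¬_; Dec; yes; no)
  open import Relation.Nullary.Decidable using (dec-true; dec-false; dec⇒maybe; _×-dec_; ¬?)
  open import Relation.Unary using (Decidable)
  open import Tactic.RingSolver using (solve-∀)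
  open import Tactic.RingSolver.Core.AlmostCommutativeRing using (AlmostCommutativeRing; fromCommutativeRing)
  open ∑ℚ

  ℚ-ring : AlmostCommutativeRing _ _
  ℚ-ring = fromCommutativeRing ℚ.+-*-commutativeRing (λ x → dec⇒maybe (0ℚ ℚ.≟ x))

  -- Embedding of ℤ and ℕ into ℚ, and clearing of denominators.

  fromℤ : ℤ → ℚ
  fromℤ i = i ℚ./ 1

  toℚᵘ-/ : ∀ i d .{{_ : NonZero d}} → toℚᵘ (i ℚ./ d) ≃ (i ℚᵘ./ d)
  toℚᵘ-/ i (suc d) = ℚ.toℚᵘ-fromℚᵘ (mkℚᵘ i d)

  -- Arithmetic on `ℚ` cancels common factors and so does not compute on variables; for unnormalised
  -- fractions the equation is a cross multiplication in ℤ.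
  fromℤ-+ : ∀ i j → fromℤ (i ℤ.+ j) ≡ fromℤ i + fromℤ j
  fromℤ-+ i j = ℚ.toℚᵘ-injective (begin-equality
    toℚᵘ (fromℤ (i ℤ.+ j))             ≃⟨ toℚᵘ-/ (i ℤ.+ j) 1 ⟩
    (i ℤ.+ j) ℚᵘ./ 1                   ≃⟨ *≡* (cong (ℤ._* ℤ.+ 1) (sym (cong₂ ℤ._+_ (ℤ.*-identityʳ i) (ℤ.*-identityʳ j)))) ⟩
    (i ℚᵘ./ 1) ℚᵘ.+ (j ℚᵘ./ 1)         ≃⟨ ℚᵘ.+-cong (toℚᵘ-/ i 1) (toℚᵘ-/ j 1) ⟨
    toℚᵘ (fromℤ i) ℚᵘ.+ toℚᵘ (fromℤ j) ≃⟨ ℚ.toℚᵘ-homo-+ (fromℤ i) (fromℤ j) ⟨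
    toℚᵘ (fromℤ i + fromℤ j)           ∎)
    where open ℚᵘ.≤-Reasoning

  fromℤ-* : ∀ i j → fromℤ (i ℤ.* j) ≡ fromℤ i * fromℤ j
  fromℤ-* i j = ℚ.toℚᵘ-injective (begin-equality
    toℚᵘ (fromℤ (i ℤ.* j))             ≃⟨ toℚᵘ-/ (i ℤ.* j) 1 ⟩
    (i ℚᵘ./ 1) ℚᵘ.* (j ℚᵘ./ 1)         ≃⟨ ℚᵘ.*-cong (toℚᵘ-/ i 1) (toℚᵘ-/ j 1) ⟨
    toℚᵘ (fromℤ i) ℚᵘ.* toℚᵘ (fromℤ j) ≃⟨ ℚ.toℚᵘ-homo-* (fromℤ i) (fromℤ j) ⟨
    toℚᵘ (fromℤ i * fromℤ j)           ∎)
    where open ℚᵘ.≤-Reasoning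

  /-*-cancel : ∀ i d .{{_ : NonZero d}} → (i ℚ./ d) * fromℕ d ≡ fromℤ i
  /-*-cancel i d@(suc _) = ℚ.toℚᵘ-injective (begin-equality
    toℚᵘ ((i ℚ./ d) * fromℕ d)         ≃⟨ ℚ.toℚᵘ-homo-* (i ℚ./ d) (fromℕ d) ⟩
    toℚᵘ (i ℚ./ d) ℚᵘ.* toℚᵘ (fromℕ d) ≃⟨ ℚᵘ.*-cong (toℚᵘ-/ i d) (toℚᵘ-/ (ℤ.+ d) 1) ⟩
    (i ℚᵘ./ d) ℚᵘ.* (ℤ.+ d ℚᵘ./ 1)     ≃⟨ *≡* (trans (ℤ.*-identityʳ (i ℤ.* ℤ.+ d))
          (cong (λ e → i ℤ.* ℤ.+ e) (sym (ℕ.*-identityʳ d)))) ⟩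
    i ℚᵘ./ 1                           ≃⟨ toℚᵘ-/ i 1 ⟨
    toℚᵘ (fromℤ i)                     ∎)
    where open ℚᵘ.≤-Reasoning

  fromℕ-+ : ∀ a b → fromℕ (a ℕ.+ b) ≡ fromℕ a + fromℕ b
  fromℕ-+ a b = fromℤ-+ (ℤ.+ a) (ℤ.+ b)

  fromℕ-* : ∀ a b → fromℕ (a ℕ.* b) ≡ fromℕ a * fromℕ b
  fromℕ-* a b = trans (cong fromℤ (ℤ.pos-* a b)) (fromℤ-* (ℤ.+ a) (ℤ.+ b))

  fromℕ-suc : ∀ a → fromℕ (suc a) ≡ 1ℚ + fromℕ a
  fromℕ-suc = fromℕ-+ 1

  recip : ∀ d .{{_ : NonZero d}} → ℚ
  recip d = ℤ.+ 1 ℚ./ d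

  recip-inverse : ∀ d .{{_ : NonZero d}} → recip d * fromℕ d ≡ 1ℚ
  recip-inverse d = /-*-cancel (ℤ.+ 1) d

  *-fromℕ-cancelʳ : ∀ {p q} d .{{_ : NonZero d}} → p * fromℕ d ≡ q * fromℕ d → p ≡ q
  *-fromℕ-cancelʳ {p} {q} d eq = begin
    p                         ≡⟨ lemma p (fromℕ d) (recip d) (recip-inverse d) ⟩
    p * fromℕ d * recip d     ≡⟨ cong (_* recip d) eq ⟩
    q * fromℕ d * recip d     ≡⟨ lemma q (fromℕ d) (recip d) (recip-inverse d) ⟨
    q                         ∎
    where
    open ≡-Reasoning
    lemma : ∀ p d e → e * d ≡ 1ℚ → p ≡ p * d * e
    lemma p d e h = trans (trans (sym (ℚ.*-identityʳ p)) (cong (p *_) (trans (sym h) (ℚ.*-comm e d)))) (sym (ℚ.*-assoc p d e))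

  kemenyNumerator : ℤ → ℤ → ℤ
  kemenyNumerator i j = (i ℤ.- ℤ.+ 1) ℤ.* (ℤ.- ℤ.+ 12 ℤ.* j ℤ.+ i ℤ.* (j ℤ.^ 2 ℤ.+ ℤ.+ 6 ℤ.* j ℤ.- ℤ.+ 1))

  -- The terms are regrouped by origin: 6 (m - 2) n comes from the m - 2 inner vertices of each
  -- copy, and m (n² - 1) from the total of the cycle Green function.
  fromℤ-kemenyNumerator : ∀ i j →
    fromℤ (kemenyNumerator i j) ≡
    (fromℤ i - 1ℚ) * (fromℕ 6 * (fromℤ i - fromℕ 2) * fromℤ j + fromℤ i * (fromℤ j * fromℤ j - 1ℚ))
  fromℤ-kemenyNumerator i j = begin
    fromℤ (kemenyNumerator i j)
      ≡⟨ trans (fromℤ-* (i ℤ.- ℤ.+ 1) (ℤ.- ℤ.+ 12 ℤ.* j ℤ.+ i ℤ.* (j ℤ.^ 2 ℤ.+ ℤ.+ 6 ℤ.* j ℤ.- ℤ.+ 1)))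
           (cong₂ _*_ (fromℤ-+ i (ℤ.- ℤ.+ 1))
             (trans (fromℤ-+ (ℤ.- ℤ.+ 12 ℤ.* j) (i ℤ.* (j ℤ.^ 2 ℤ.+ ℤ.+ 6 ℤ.* j ℤ.- ℤ.+ 1)))
               (cong₂ _+_ (fromℤ-* (ℤ.- ℤ.+ 12) j)
                 (trans (fromℤ-* i (j ℤ.^ 2 ℤ.+ ℤ.+ 6 ℤ.* j ℤ.- ℤ.+ 1))
                   (cong (fromℤ i *_) (trans (fromℤ-+ (j ℤ.^ 2 ℤ.+ ℤ.+ 6 ℤ.* j) (ℤ.- ℤ.+ 1))
                     (cong (_+ (ℚ.- 1ℚ)) (trans (fromℤ-+ (j ℤ.^ 2) (ℤ.+ 6 ℤ.* j))
                       (cong₂ _+_ (trans (fromℤ-* j (j ℤ.* ℤ.+ 1)) (cong (fromℤ j *_) (fromℤ-* j (ℤ.+ 1))))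
                            (fromℤ-* (ℤ.+ 6) j)))))))))) ⟩
    (fromℤ i - 1ℚ) * ((ℚ.- fromℕ 12) * fromℤ j + fromℤ i * (fromℤ j * (fromℤ j * 1ℚ) + fromℕ 6 * fromℤ j - 1ℚ))
      ≡⟨ lemma (fromℤ i) (fromℤ j) ⟩
    (fromℤ i - 1ℚ) * (fromℕ 6 * (fromℤ i - fromℕ 2) * fromℤ j + fromℤ i * (fromℤ j * fromℤ j - 1ℚ)) ∎
    where
    open ≡-Reasoning
    lemma : ∀ m n → (m - 1ℚ) * ((ℚ.- fromℕ 12) * n + m * (n * (n * 1ℚ) + fromℕ 6 * n - 1ℚ)) ≡
                    (m - 1ℚ) * (fromℕ 6 * (m - fromℕ 2) * n + m * (n * n - 1ℚ))
    lemma = solve-∀ ℚ-ring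

  -- Finite sums, indicators, and pseudoinverses by double centring.

  module FiniteSums where

    private variable
      n : ℕ
      A B : Set

    ∑-fromℕ : (f : Fin n → ℕ) → fromℕ (∑ℕ.sum f) ≡ ∑[ i < n ] fromℕ (f i)
    ∑-fromℕ {zero}  f = refl
    ∑-fromℕ {suc n} f = trans (fromℕ-+ (f zero) _) (cong (fromℕ (f zero) +_) (∑-fromℕ (f ∘ suc)))

    ∑-const : ∀ n c → ∑[ i < n ] c ≡ fromℕ n * c
    ∑-const zero    c = sym (ℚ.*-zeroˡ c)
    ∑-const (suc n) c = begin
      c + ∑[ i < n ] c     ≡⟨ cong (c +_) (∑-const n c) ⟩
      c + fromℕ n * c      ≡⟨ lemma c (fromℕ n) ⟩
      (1ℚ + fromℕ n) * c   ≡⟨ cong (_* c) (fromℕ-suc n) ⟨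
      fromℕ (suc n) * c    ∎
      where
      open ≡-Reasoning
      lemma : ∀ c k → c + k * c ≡ (1ℚ + k) * c
      lemma = solve-∀ ℚ-ring

    ∑-distrib-- : (f g : Fin n → ℚ) → ∑[ i < n ] (f i - g i) ≡ sum f - sum g
    ∑-distrib-- {zero}  f g = refl
    ∑-distrib-- {suc n} f g = begin
      f zero - g zero + ∑[ i < n ] (f (suc i) - g (suc i))
        ≡⟨ cong (f zero - g zero +_) (∑-distrib-- (f ∘ suc) (g ∘ suc)) ⟩
      f zero - g zero + (sum (f ∘ suc) - sum (g ∘ suc))
        ≡⟨ lemma (f zero) (g zero) (sum (f ∘ suc)) (sum (g ∘ suc)) ⟩
      (f zero + sum (f ∘ suc)) - (g zero + sum (g ∘ suc)) ∎
      where
      open ≡-Reasoning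
      lemma : ∀ a b c d → a - b + (c - d) ≡ (a + c) - (b + d)
      lemma = solve-∀ ℚ-ring

    ∑-linear : ∀ a b (f g : Fin n → ℚ) → ∑[ i < n ] (a * f i + b * g i) ≡ a * sum f + b * sum g
    ∑-linear a b f g = trans (∑-distrib-+ (λ i → a * f i) (λ i → b * g i))
      (sym (cong₂ _+_ (*-distribˡ-sum a f) (*-distribˡ-sum b g)))

    ∑-unit : (i : Fin n) (f : Fin n → ℚ) → ∑[ k < n ] (unit i k * f k) ≡ f i
    ∑-unit {suc n} zero f = begin
      1ℚ * f zero + ∑[ k < n ] (0ℚ * f (suc k))
        ≡⟨ cong₂ _+_ (ℚ.*-identityˡ (f zero)) (sym (*-distribˡ-sum 0ℚ (f ∘ suc))) ⟩
      f zero + 0ℚ * sum (f ∘ suc) ≡⟨ cong (f zero +_) (ℚ.*-zeroˡ (sum (f ∘ suc))) ⟩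
      f zero + 0ℚ                 ≡⟨ ℚ.+-identityʳ (f zero) ⟩
      f zero                      ∎
      where open ≡-Reasoning
    ∑-unit {suc n} (suc i) f =
      trans (cong (_+ ∑[ k < n ] (unit i k * f (suc k))) (ℚ.*-zeroˡ (f zero)))
            (trans (ℚ.+-identityˡ _) (∑-unit i (f ∘ suc)))

    𝟙-cong : (a? : Dec A) (b? : Dec B) → (A → B) → (B → A) → 𝟙 a? ≡ 𝟙 b?
    𝟙-cong (yes a) (yes b) f g = refl
    𝟙-cong (yes a) (no ¬b) f g = ⊥-elim (¬b (f a))
    𝟙-cong (no ¬a) (yes b) f g = ⊥-elim (¬a (g b))
    𝟙-cong (no ¬a) (no ¬b) f g = refl

    𝟙-yes : (a? : Dec A) → A → 𝟙 a? ≡ 1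
    𝟙-yes a? a rewrite dec-true a? a = refl

    𝟙-no : (a? : Dec A) → ¬ A → 𝟙 a? ≡ 0
    𝟙-no a? ¬a rewrite dec-false a? ¬a = refl

    𝟙-× : (a? : Dec A) (b? : Dec B) → 𝟙 (a? ×-dec b?) ≡ 𝟙 a? ℕ.* 𝟙 b?
    𝟙-× (yes _) (yes _) = refl
    𝟙-× (yes _) (no  _) = refl
    𝟙-× (no  _) b?      = refl

    -- `any?` detects a witness but does not count; with at most one witness the two agree. This
    -- turns the existential adjacency of the flower into a sum.
    𝟙-any-unique : {P : Fin n → Set} (P? : Decidable P) → (∀ {i j} → P i → P j → i ≡ j) →
                   𝟙 (any? P?) ≡ ∑ℕ.sum (λ i → 𝟙 (P? i))
    𝟙-any-unique {zero}      P? unique = refl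
    𝟙-any-unique {suc n} {P} P? unique with P? zero
    ... | yes p₀ = cong suc (sym (none (P? ∘ suc) (λ i p → Fin.0≢1+n (unique p₀ p))))
      where
      none : ∀ {k} {Q : Fin k → Set} (Q? : Decidable Q) → (∀ i → ¬ Q i) → ∑ℕ.sum (λ i → 𝟙 (Q? i)) ≡ 0
      none {zero}  Q? ¬q = refl
      none {suc k} Q? ¬q = cong₂ ℕ._+_ (𝟙-no (Q? zero) (¬q zero)) (none (Q? ∘ suc) (¬q ∘ suc))
    ... | no ¬p₀ = 𝟙-any-unique (P? ∘ suc) (λ p q → Fin.suc-injective (unique p q))

    fromℕ-𝟙-any : {P : Fin n → Set} (P? : Decidable P) → (∀ {i j} → P i → P j → i ≡ j) →
                  fromℕ (𝟙 (any? P?)) ≡ ∑[ i < n ] fromℕ (𝟙 (P? i))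
    fromℕ-𝟙-any P? unique = trans (cong fromℕ (𝟙-any-unique P? unique)) (∑-fromℕ (λ i → 𝟙 (P? i)))

    ∑-unit-difference : (i j : Fin n) (f : Fin n → ℚ) → ∑[ k < n ] ((unit i k - unit j k) * f k) ≡ f i - f j
    ∑-unit-difference i j f = begin
      ∑[ k < _ ] ((unit i k - unit j k) * f k)          ≡⟨ sum-cong-≗ (λ k → lemma (unit i k) (unit j k) (f k)) ⟩
      ∑[ k < _ ] (unit i k * f k - unit j k * f k)      ≡⟨ ∑-distrib-- (λ k → unit i k * f k) (λ k → unit j k * f k) ⟩
      ∑[ k < _ ] (unit i k * f k) - ∑[ k < _ ] (unit j k * f k) ≡⟨ cong₂ _-_ (∑-unit i f) (∑-unit j f) ⟩
      f i - f j                                         ∎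
      where
      open ≡-Reasoning
      lemma : ∀ a b c → (a - b) * c ≡ a * c - b * c
      lemma = solve-∀ ℚ-ring

    resistance-expand : (M : Mat n) (i j : Fin n) → resistance M i j ≡ (M i i - M i j) - (M j i - M j j)
    resistance-expand {n} M i j = begin
      ∑[ a < n ] ∑[ b < n ] ((unit i a - unit j a) * M a b * (unit i b - unit j b))
        ≡⟨ sum-cong-≗ {n} (λ a → sum-cong-≗ {n} (λ b → lemma₁ (unit i a - unit j a) (M a b) (unit i b - unit j b))) ⟩
      ∑[ a < n ] ∑[ b < n ] ((unit i b - unit j b) * ((unit i a - unit j a) * M a b))
        ≡⟨ sum-cong-≗ {n} (λ a → ∑-unit-difference i j (λ b → (unit i a - unit j a) * M a b)) ⟩
      ∑[ a < n ] ((unit i a - unit j a) * M a i - (unit i a - unit j a) * M a j)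
        ≡⟨ sum-cong-≗ {n} (λ a → lemma₂ (unit i a - unit j a) (M a i) (M a j)) ⟩
      ∑[ a < n ] ((unit i a - unit j a) * (M a i - M a j))
        ≡⟨ ∑-unit-difference i j (λ a → M a i - M a j) ⟩
      (M i i - M i j) - (M j i - M j j) ∎
      where
      open ≡-Reasoning
      lemma₁ : ∀ x y z → x * y * z ≡ z * (x * y)
      lemma₁ = solve-∀ ℚ-ring
      lemma₂ : ∀ x y z → x * y - x * z ≡ x * (y - z)
      lemma₂ = solve-∀ ℚ-ring

    unit-sym : (i j : Fin n) → unit i j ≡ unit j i
    unit-sym i j = cong fromℕ (𝟙-cong (i ≟ j) (j ≟ i) sym sym)

    unit-transport : (i j : Fin n) (f : Fin n → ℚ) → unit i j * f j ≡ unit i j * f i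
    unit-transport i j f with i ≟ j
    ... | yes refl = refl
    ... | no _     = trans (ℚ.*-zeroˡ (f j)) (sym (ℚ.*-zeroˡ (f i)))

    ∑-unit-row : (i : Fin n) → ∑[ k < n ] unit i k ≡ 1ℚ
    ∑-unit-row i = trans (sum-cong-≗ (λ k → sym (ℚ.*-identityʳ (unit i k)))) (∑-unit i (λ _ → 1ℚ))

    -- If A has zero row sums and A Z = s I - w 1ᵀ, then s⁻¹ Z is a generalised inverse of A,
    -- and double centring turns it into the pseudoinverse without changing resistances.
    module Centring {N} .{{_ : NonZero N}} (A Z : Mat N) (w : Fin N → ℚ) (s : ℕ) .{{_ : NonZero s}}
      (A-sym : A ᵀ ≋ A) (A-rows : ∀ i → ∑[ j < N ] A i j ≡ 0ℚ) (Z-sym : Z ᵀ ≋ Z)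
      (A⊗Z : ∀ i j → (A ⊗ Z) i j ≡ fromℕ s * unit i j - w i) where

      open ≡-Reasoning

      private
        ν ι : ℚ
        ν = recip N
        ι = recip s

        mean : Fin N → ℚ
        mean i = ν * sum (Z i)

        grandMean : ℚ
        grandMean = ν * sum mean

      pinv : Mat N
      pinv i j = ι * ((Z i j - mean i) - (mean j - grandMean))

      private
        P : Mat N
        P i j = unit i j - ν

        -- This averages row i of A Z = s I - w 1ᵀ: the diagonal contributes s / N, while `w i` is
        -- constant along the row and survives unchanged. Subtracting the means therefore removes w.
        A-mean : ∀ i → ∑[ k < N ] (A i k * mean k) ≡ ν * fromℕ s - w i
        A-mean i = begin
          ∑[ k < N ] (A i k * (ν * sum (Z k)))
            ≡⟨ sum-cong-≗ (λ k → trans (lemma₁ (A i k) ν (sum (Z k))) (cong (ν *_) (*-distribˡ-sum (A i k) (Z k)))) ⟩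
          ∑[ k < N ] (ν * ∑[ l < N ] (A i k * Z k l))
            ≡⟨ *-distribˡ-sum ν (λ k → ∑[ l < N ] (A i k * Z k l)) ⟨
          ν * ∑[ k < N ] ∑[ l < N ] (A i k * Z k l)
            ≡⟨ cong (ν *_) (∑-comm (λ k l → A i k * Z k l)) ⟩
          ν * ∑[ l < N ] (A ⊗ Z) i l
            ≡⟨ cong (ν *_) (sum-cong-≗ (A⊗Z i)) ⟩
          ν * ∑[ l < N ] (fromℕ s * unit i l - w i)
            ≡⟨ cong (ν *_) (∑-distrib-- (λ l → fromℕ s * unit i l) (λ _ → w i)) ⟩
          ν * (∑[ l < N ] (fromℕ s * unit i l) - ∑[ l < N ] w i)
            ≡⟨ cong₂ (λ a b → ν * (a - b)) (trans (sym (*-distribˡ-sum (fromℕ s) (unit i))) (cong (fromℕ s *_) (∑-unit-row i)))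
               (∑-const N (w i)) ⟩
          ν * (fromℕ s * 1ℚ - fromℕ N * w i)
            ≡⟨ lemma₂ ν (fromℕ s) (fromℕ N) (w i) ⟩
          ν * fromℕ s - ν * fromℕ N * w i
            ≡⟨ cong (λ a → ν * fromℕ s - a * w i) (recip-inverse N) ⟩
          ν * fromℕ s - 1ℚ * w i
            ≡⟨ cong ((ν * fromℕ s) -_) (ℚ.*-identityˡ (w i)) ⟩
          ν * fromℕ s - w i ∎
          where
          lemma₁ : ∀ a b c → a * (b * c) ≡ b * (a * c)
          lemma₁ = solve-∀ ℚ-ring
          lemma₂ : ∀ v s n w → v * (s * 1ℚ - n * w) ≡ v * s - v * n * w
          lemma₂ = solve-∀ ℚ-ring

        -- The drain w cancels between Z and its means, and the corrections depending only on j are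
        -- killed by the zero row sums of A. What is left is the orthogonal projector onto the
        -- vectors of sum zero.
        A⊗pinv : A ⊗ pinv ≋ P
        A⊗pinv i j = begin
          ∑[ k < N ] (A i k * (ι * ((Z k j - mean k) - (mean j - grandMean))))
            ≡⟨ sum-cong-≗ (λ k → lemma₁ (A i k) ι (Z k j) (mean k) (mean j - grandMean)) ⟩
          ∑[ k < N ] (ι * (A i k * Z k j - A i k * mean k) + (ℚ.- (ι * (mean j - grandMean))) * A i k)
            ≡⟨ ∑-linear ι (ℚ.- (ι * (mean j - grandMean))) (λ k → A i k * Z k j - A i k * mean k) (A i) ⟩
          ι * ∑[ k < N ] (A i k * Z k j - A i k * mean k) + (ℚ.- (ι * (mean j - grandMean))) * sum (A i)
            ≡⟨ cong₂ (λ a b → ι * a + (ℚ.- (ι * (mean j - grandMean))) * b)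
                 (trans (∑-distrib-- (λ k → A i k * Z k j) (λ k → A i k * mean k)) (cong₂ _-_ (A⊗Z i j) (A-mean i))) (A-rows i) ⟩
          ι * ((fromℕ s * unit i j - w i) - (ν * fromℕ s - w i)) + (ℚ.- (ι * (mean j - grandMean))) * 0ℚ
            ≡⟨ lemma₂ ι (fromℕ s) (unit i j) (w i) ν (mean j - grandMean) ⟩
          (ι * fromℕ s) * P i j
            ≡⟨ cong (_* P i j) (recip-inverse s) ⟩
          1ℚ * P i j
            ≡⟨ ℚ.*-identityˡ (P i j) ⟩
          P i j ∎
          where
          lemma₁ : ∀ a i z m g → a * (i * ((z - m) - g)) ≡ i * (a * z - a * m) + (ℚ.- (i * g)) * a
          lemma₁ = solve-∀ ℚ-ring
          lemma₂ : ∀ i s u w v g → i * ((s * u - w) - (v * s - w)) + (ℚ.- (i * g)) * 0ℚ ≡ (i * s) * (u - v)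
          lemma₂ = solve-∀ ℚ-ring

        P-sym : P ᵀ ≋ P
        P-sym i j = cong (_- ν) (unit-sym j i)

        pinv-sym : pinv ᵀ ≋ pinv
        pinv-sym i j = trans (cong (λ z → ι * ((z - mean j) - (mean i - grandMean))) (Z-sym i j))
                             (lemma ι (Z i j) (mean i) (mean j) grandMean)
          where
          lemma : ∀ i z a b g → i * ((z - b) - (a - g)) ≡ i * ((z - a) - (b - g))
          lemma = solve-∀ ℚ-ring

        pinv⊗A : pinv ⊗ A ≋ P
        pinv⊗A i j = begin
          (pinv ⊗ A) i j      ≡⟨ ⊗-ᵀ pinv A j i ⟩
          (A ᵀ ⊗ pinv ᵀ) j i  ≡⟨ ⊗-cong A-sym pinv-sym j i ⟩
          (A ⊗ pinv) j i      ≡⟨ A⊗pinv j i ⟩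
          P j i               ≡⟨ P-sym i j ⟩
          P i j               ∎

        -- Subtracting its mean from a column of sum zero changes nothing. Applied to A and to
        -- `pinv`, this gives the first two Penrose conditions.
        P⊗ : (B : Mat N) → (∀ j → ∑[ i < N ] B i j ≡ 0ℚ) → P ⊗ B ≋ B
        P⊗ B cols i j = begin
          ∑[ k < N ] ((unit i k - ν) * B k j)
            ≡⟨ sum-cong-≗ (λ k → lemma₁ (unit i k) ν (B k j)) ⟩
          ∑[ k < N ] (unit i k * B k j - ν * B k j)
            ≡⟨ ∑-distrib-- (λ k → unit i k * B k j) (λ k → ν * B k j) ⟩
          ∑[ k < N ] (unit i k * B k j) - ∑[ k < N ] (ν * B k j)
            ≡⟨ cong₂ _-_ (∑-unit i (λ k → B k j)) (trans (sym (*-distribˡ-sum ν (λ k → B k j))) (cong (ν *_) (cols j))) ⟩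
          B i j - ν * 0ℚ
            ≡⟨ lemma₂ (B i j) ν ⟩
          B i j ∎
          where
          lemma₁ : ∀ u v b → (u - v) * b ≡ u * b - v * b
          lemma₁ = solve-∀ ℚ-ring
          lemma₂ : ∀ b v → b - v * 0ℚ ≡ b
          lemma₂ = solve-∀ ℚ-ring

        pinv-rows : ∀ i → sum (pinv i) ≡ 0ℚ
        pinv-rows i = begin
          ∑[ j < N ] (ι * ((Z i j - mean i) - (mean j - grandMean)))
            ≡⟨ *-distribˡ-sum ι (λ j → (Z i j - mean i) - (mean j - grandMean)) ⟨
          ι * ∑[ j < N ] ((Z i j - mean i) - (mean j - grandMean))
            ≡⟨ cong (ι *_) (trans (∑-distrib-- (λ j → Z i j - mean i) (λ j → mean j - grandMean))
                 (cong₂ _-_ (centred (Z i)) (centred mean))) ⟩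
          ι * (0ℚ - 0ℚ)
            ≡⟨ ℚ.*-zeroʳ ι ⟩
          0ℚ ∎
          where
          lemma : ∀ x n v → x - n * (v * x) ≡ x * (1ℚ - v * n)
          lemma = solve-∀ ℚ-ring
          centred : ∀ f → ∑[ j < N ] (f j - ν * sum f) ≡ 0ℚ
          centred f = begin
            ∑[ j < N ] (f j - ν * sum f)         ≡⟨ ∑-distrib-- f (λ _ → ν * sum f) ⟩
            sum f - ∑[ j < N ] (ν * sum f)       ≡⟨ cong (sum f -_) (∑-const N (ν * sum f)) ⟩
            sum f - fromℕ N * (ν * sum f)        ≡⟨ lemma (sum f) (fromℕ N) ν ⟩
            sum f * (1ℚ - ν * fromℕ N)           ≡⟨ cong (λ a → sum f * (1ℚ - a)) (recip-inverse N) ⟩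
            sum f * (1ℚ - 1ℚ)                    ≡⟨ ℚ.*-zeroʳ (sum f) ⟩
            0ℚ                                   ∎

      isPseudoinverse : IsPseudoinverse A pinv
      isPseudoinverse = record
        { AA†A≋A   = ≋-trans (⊗-congʳ A A⊗pinv) (P⊗ A (λ j → trans (sum-cong-≗ (λ i → A-sym j i)) (A-rows j)))
        ; A†AA†≋A† = ≋-trans (⊗-congʳ pinv pinv⊗A) (P⊗ pinv (λ j → trans (sum-cong-≗ (λ i → pinv-sym j i)) (pinv-rows j)))
        ; AA†-sym  = λ i j → trans (A⊗pinv j i) (trans (P-sym i j) (sym (A⊗pinv i j)))
        ; A†A-sym  = λ i j → trans (pinv⊗A j i) (trans (P-sym i j) (sym (pinv⊗A i j)))
        }

      resistance-pinv : ∀ i j → resistance pinv i j ≡ ι * ((Z i i + Z j j) - (Z i j + Z i j))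
      resistance-pinv i j = begin
        resistance pinv i j
          ≡⟨ resistance-expand pinv i j ⟩
        (pinv i i - pinv i j) - (pinv j i - pinv j j)
          ≡⟨ cong (λ z → (pinv i i - pinv i j) - (ι * ((z - mean j) - (mean i - grandMean)) - pinv j j)) (Z-sym i j) ⟩
        (pinv i i - pinv i j) - (ι * ((Z i j - mean j) - (mean i - grandMean)) - pinv j j)
          ≡⟨ lemma ι (Z i i) (Z i j) (Z j j) (mean i) (mean j) grandMean ⟩
        ι * ((Z i i + Z j j) - (Z i j + Z i j)) ∎
        where
        lemma : ∀ e p q r a b g →
          (e * ((p - a) - (a - g)) - e * ((q - a) - (b - g))) - (e * ((q - b) - (a - g)) - e * ((r - b) - (b - g)))
          ≡ e * ((p + r) - (q + q))
        lemma = solve-∀ ℚ-ring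

      module _ (H : Graph N) where
        private
          d : Fin N → ℚ
          d i = fromℕ (degree H i)

        -- By the symmetry between i and j both diagonal terms of the resistance contribute the same
        -- amount, hence the common factor 2. Only degree-weighted sums of Z remain, and these can
        -- be taken copy by copy.
        weightedResistanceSum-pinv :
          weightedResistanceSum H pinv ≡
          fromℕ 2 * ι * (sum d * ∑[ i < N ] (d i * Z i i) - ∑[ j < N ] (d j * ∑[ i < N ] (d i * Z i j)))
        weightedResistanceSum-pinv = begin
          ∑[ i < N ] ∑[ j < N ] (d i * d j * resistance pinv i j)
            ≡⟨ sum-cong-≗ (λ i → sum-cong-≗ (λ j → trans (cong (d i * d j *_) (resistance-pinv i j))
                 (lemma₁ ι (d i) (d j) (Z i i) (Z i j) (Z j j)))) ⟩
          ∑[ i < N ] ∑[ j < N ] (ι * ((d i * Z i i) * d j + d i * (d j * Z j j)) + (ℚ.- (fromℕ 2 * ι)) * (d j * (d i * Z i j)))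
            ≡⟨ sum-cong-≗ (λ i → trans (∑-linear ι (ℚ.- (fromℕ 2 * ι))
                   (λ j → (d i * Z i i) * d j + d i * (d j * Z j j)) (λ j → d j * (d i * Z i j)))
                 (cong (λ a → ι * a + (ℚ.- (fromℕ 2 * ι)) * ∑[ j < N ] (d j * (d i * Z i j)))
                     (trans (∑-linear (d i * Z i i) (d i) d (λ j → d j * Z j j)) (lemma₂ (d i * Z i i) (sum d) (d i) T)))) ⟩
          ∑[ i < N ] (ι * (sum d * (d i * Z i i) + T * d i) + (ℚ.- (fromℕ 2 * ι)) * ∑[ j < N ] (d j * (d i * Z i j)))
            ≡⟨ ∑-linear ι (ℚ.- (fromℕ 2 * ι)) (λ i → sum d * (d i * Z i i) + T * d i) (λ i → ∑[ j < N ] (d j * (d i * Z i j))) ⟩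
          ι * ∑[ i < N ] (sum d * (d i * Z i i) + T * d i) + (ℚ.- (fromℕ 2 * ι)) * ∑[ i < N ] ∑[ j < N ] (d j * (d i * Z i j))
            ≡⟨ cong₂ (λ a b → ι * a + (ℚ.- (fromℕ 2 * ι)) * b) (∑-linear (sum d) T (λ i → d i * Z i i) d)
                 (trans (∑-comm (λ i j → d j * (d i * Z i j))) (sum-cong-≗ (λ j → sym (*-distribˡ-sum (d j) (λ i → d i * Z i j))))) ⟩
          ι * (sum d * T + T * sum d) + (ℚ.- (fromℕ 2 * ι)) * Q
            ≡⟨ lemma₃ ι (sum d) T Q ⟩
          fromℕ 2 * ι * (sum d * T - Q) ∎
          where
          T = ∑[ i < N ] (d i * Z i i)
          Q = ∑[ j < N ] (d j * ∑[ i < N ] (d i * Z i j))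
          lemma₁ : ∀ e a b p q r → a * b * (e * ((p + r) - (q + q))) ≡
              e * ((a * p) * b + a * (b * r)) + (ℚ.- (fromℕ 2 * e)) * (b * (a * q))
          lemma₁ = solve-∀ ℚ-ring
          lemma₂ : ∀ a b c d → a * b + c * d ≡ b * a + d * c
          lemma₂ = solve-∀ ℚ-ring
          lemma₃ : ∀ e s t q → e * (s * t + t * s) + (ℚ.- (fromℕ 2 * e)) * q ≡ fromℕ 2 * e * (s * t - q)
          lemma₃ = solve-∀ ℚ-ring

    -- The Laplacian of an arbitrary graph and the handshake identity.

    module _ {N} (H : Graph N) where
      open Graph H

      laplacian-sym : laplacian H ᵀ ≋ laplacian H
      laplacian-sym i j = cong₂ (λ a b → fromℕ a - fromℕ b) diagonal (𝟙-cong (adj? j i) (adj? i j) adj-sym adj-sym)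
        where
        diagonal : degree H j ℕ.* 𝟙 (j ≟ i) ≡ degree H i ℕ.* 𝟙 (i ≟ j)
        diagonal with i ≟ j | j ≟ i
        ... | yes refl | yes _   = refl
        ... | yes i≡j  | no  j≢i = ⊥-elim (j≢i (sym i≡j))
        ... | no  i≢j  | yes j≡i = ⊥-elim (i≢j (sym j≡i))
        ... | no  _    | no  _   = trans (ℕ.*-zeroʳ (degree H j)) (sym (ℕ.*-zeroʳ (degree H i)))

      laplacian-apply : ∀ i (f : Fin N → ℚ) → ∑[ j < N ] (laplacian H i j * f j) ≡
                        fromℕ (degree H i) * f i - ∑[ j < N ] (fromℕ (𝟙 (adj? i j)) * f j)
      laplacian-apply i f = begin
        ∑[ j < N ] (laplacian H i j * f j)
          ≡⟨ sum-cong-≗ (λ j → trans (cong (λ a → (a - fromℕ (𝟙 (adj? i j))) * f j) (fromℕ-* (degree H i) (𝟙 (i ≟ j))))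
               (lemma (fromℕ (degree H i)) (unit i j) (fromℕ (𝟙 (adj? i j))) (f j))) ⟩
        ∑[ j < N ] (fromℕ (degree H i) * (unit i j * f j) - fromℕ (𝟙 (adj? i j)) * f j)
          ≡⟨ ∑-distrib-- (λ j → fromℕ (degree H i) * (unit i j * f j)) (λ j → fromℕ (𝟙 (adj? i j)) * f j) ⟩
        ∑[ j < N ] (fromℕ (degree H i) * (unit i j * f j)) - ∑[ j < N ] (fromℕ (𝟙 (adj? i j)) * f j)
          ≡⟨ cong (_- ∑[ j < N ] (fromℕ (𝟙 (adj? i j)) * f j))
               (trans (sym (*-distribˡ-sum (fromℕ (degree H i)) (λ j → unit i j * f j))) (cong (fromℕ (degree H i) *_) (∑-unit i f))) ⟩
        fromℕ (degree H i) * f i - ∑[ j < N ] (fromℕ (𝟙 (adj? i j)) * f j) ∎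
        where
        open ≡-Reasoning
        lemma : ∀ d u a f → (d * u - a) * f ≡ d * (u * f) - a * f
        lemma = solve-∀ ℚ-ring

      laplacian-rows : ∀ i → ∑[ j < N ] laplacian H i j ≡ 0ℚ
      laplacian-rows i = begin
        ∑[ j < N ] laplacian H i j                    ≡⟨ sum-cong-≗ (λ j → sym (ℚ.*-identityʳ (laplacian H i j))) ⟩
        ∑[ j < N ] (laplacian H i j * 1ℚ)             ≡⟨ laplacian-apply i (λ _ → 1ℚ) ⟩
        fromℕ (degree H i) * 1ℚ - ∑[ j < N ] (fromℕ (𝟙 (adj? i j)) * 1ℚ)
          ≡⟨ cong₂ _-_ (ℚ.*-identityʳ (fromℕ (degree H i))) (sum-cong-≗ (λ j → ℚ.*-identityʳ (fromℕ (𝟙 (adj? i j))))) ⟩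
        fromℕ (degree H i) - ∑[ j < N ] fromℕ (𝟙 (adj? i j))
          ≡⟨ cong (fromℕ (degree H i) -_) (∑-fromℕ (λ j → 𝟙 (adj? i j))) ⟨
        fromℕ (degree H i) - fromℕ (degree H i)       ≡⟨ ℚ.+-inverseʳ (fromℕ (degree H i)) ⟩
        0ℚ ∎
        where open ≡-Reasoning

      -- Transposing one of the two sums makes every ordered pair appear once with each orientation;
      -- exactly one orientation is increasing off the diagonal, and irreflexivity settles the
      -- diagonal.
      handshake : edgeCount H ℕ.+ edgeCount H ≡ ∑ℕ.sum (degree H)
      handshake = begin
        ∑ℕ.sum (λ u → ∑ℕ.sum (λ v → up u v)) ℕ.+ ∑ℕ.sum (λ u → ∑ℕ.sum (λ v → up u v))
          ≡⟨ cong (∑ℕ.sum (λ u → ∑ℕ.sum (λ v → up u v)) ℕ.+_) (∑ℕ.∑-comm up) ⟩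
        ∑ℕ.sum (λ u → ∑ℕ.sum (λ v → up u v)) ℕ.+ ∑ℕ.sum (λ u → ∑ℕ.sum (λ v → up v u))
          ≡⟨ ∑ℕ.∑-distrib-+ (λ u → ∑ℕ.sum (λ v → up u v)) (λ u → ∑ℕ.sum (λ v → up v u)) ⟨
        ∑ℕ.sum (λ u → ∑ℕ.sum (λ v → up u v) ℕ.+ ∑ℕ.sum (λ v → up v u))
          ≡⟨ ∑ℕ.sum-cong-≗ (λ u → trans (sym (∑ℕ.∑-distrib-+ (λ v → up u v) (λ v → up v u))) (∑ℕ.sum-cong-≗ (orient u))) ⟩
        ∑ℕ.sum (degree H) ∎
        where
        open ≡-Reasoning
        up : Fin N → Fin N → ℕ
        up u v = 𝟙 ((u <? v) ×-dec adj? u v)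
        oriented : ∀ {u v} → u Fin.< v → up u v ≡ 𝟙 (adj? u v)
        oriented {u} {v} u<v = 𝟙-cong ((u <? v) ×-dec adj? u v) (adj? u v) proj₂ (u<v ,_)
        reversed : ∀ {u v} → ¬ u Fin.< v → up u v ≡ 0
        reversed {u} {v} u≮v = 𝟙-no ((u <? v) ×-dec adj? u v) (u≮v ∘ proj₁)
        orient : ∀ u v → up u v ℕ.+ up v u ≡ 𝟙 (adj? u v)
        orient u v with Fin.<-cmp u v
        ... | tri< u<v _ v≮u = trans (cong₂ ℕ._+_ (oriented u<v) (reversed v≮u)) (ℕ.+-identityʳ _)
        ... | tri≈ u≮u refl _ = trans (cong₂ ℕ._+_ (reversed u≮u) (reversed u≮u)) (sym (𝟙-no (adj? u u) adj-irrefl))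
        ... | tri> u≮v _ v<u = trans (cong₂ ℕ._+_ (reversed u≮v) (oriented v<u)) (𝟙-cong (adj? v u) (adj? u v) adj-sym adj-sym)

  open FiniteSums

  -- The cyclic successor and the Green function of the n-cycle.

  module Cycle where

    private variable
      n : ℕ

    next-inject₁ : (i : Fin n) → next (inject₁ i) ≡ suc i
    next-inject₁ {n} i = Fin.toℕ-injective (trans (Fin.toℕ-fromℕ< _)
      (trans (cong (λ a → suc a ℕ.% suc n) (Fin.toℕ-inject₁ i)) (ℕ.m<n⇒m%n≡m (ℕ.s≤s (Fin.toℕ<n i)))))

    next-fromℕ : ∀ n → next (Fin.fromℕ n) ≡ zero
    next-fromℕ n = Fin.toℕ-injective (trans (Fin.toℕ-fromℕ< _)
      (trans (cong (λ a → suc a ℕ.% suc n) (Fin.toℕ-fromℕ n)) (ℕ.n%n≡0 (suc n))))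

    -- Given by cases instead of by arithmetic modulo n, so that matching on `zero` and `suc`
    -- isolates the one step that crosses the seam of the cycle.
    prev : Fin n → Fin n
    prev zero    = Fin.fromℕ _
    prev (suc i) = inject₁ i

    next-prev : (i : Fin n) → next (prev i) ≡ i
    next-prev zero    = next-fromℕ _
    next-prev (suc i) = next-inject₁ i

    prev-next : (i : Fin n) → prev (next i) ≡ i
    prev-next {suc n} i with view i
    ... | ‵fromℕ     = cong prev (next-fromℕ n)
    ... | ‵inject₁ j = cong prev (next-inject₁ j)

    unit-prev : (i j : Fin n) → unit (prev i) j ≡ unit i (next j)
    unit-prev i j = cong fromℕ (𝟙-cong (prev i ≟ j) (i ≟ next j)
      (λ e → trans (sym (next-prev i)) (cong next e)) (λ e → trans (cong prev e) (prev-next j)))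

    next-injective : {i j : Fin n} → next i ≡ next j → i ≡ j
    next-injective {i = i} {j} eq = trans (sym (prev-next i)) (trans (cong prev eq) (prev-next j))

    toℕ-next : (i : Fin (suc n)) → toℕ (next i) ≡ suc (toℕ i) ⊎ (toℕ (next i) ≡ 0 × toℕ i ≡ n)
    toℕ-next {n} i with view i
    ... | ‵fromℕ     = inj₂ (cong toℕ (next-fromℕ n) , Fin.toℕ-fromℕ n)
    ... | ‵inject₁ j = inj₁ (trans (cong toℕ (next-inject₁ j)) (cong suc (sym (Fin.toℕ-inject₁ j))))

    -- Two steps could return to i only by crossing the seam, and each way of doing so forces n - 1
    -- to be at most 1. This excludes two copies that are successors of each other.
    next²-≢ : 3 ℕ.≤ n → (i : Fin n) → next (next i) ≢ i
    next²-≢ {suc (suc (suc n))} (ℕ.s≤s (ℕ.s≤s (ℕ.s≤s _))) i eq with toℕ-next i | toℕ-next (next i) | cong toℕ eq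
    ... | inj₁ p       | inj₁ q       | r = ℕ.m≢1+n+m (toℕ i) {1} (trans (sym r) (trans q (cong suc p)))
    ... | inj₁ p       | inj₂ (q , s) | r with () ← trans (sym s) (trans p (cong suc (trans (sym r) q)))
    ... | inj₂ (p , t) | inj₁ q       | r with () ← trans (sym t) (trans (sym r) (trans q (cong suc p)))
    ... | inj₂ (p , t) | inj₂ (q , s) | r with () ← trans (sym p) s

    ∑-next : (f : Fin n → ℚ) → ∑[ i < n ] f (next i) ≡ sum f
    ∑-next {zero}  f = refl
    ∑-next {suc n} f = begin
      ∑[ i < suc n ] f (next i)
        ≡⟨ sum-init-last (f ∘ next) ⟩
      ∑[ i < n ] f (next (inject₁ i)) + f (next (Fin.fromℕ n))
        ≡⟨ cong₂ _+_ (sum-cong-≗ (λ i → cong f (next-inject₁ i))) (cong f (next-fromℕ n)) ⟩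
      ∑[ i < n ] f (suc i) + f zero
        ≡⟨ ℚ.+-comm (∑[ i < n ] f (suc i)) (f zero) ⟩
      sum f ∎
      where open ≡-Reasoning

    fromℕ-∣-∣ : ∀ {a b} → b ℕ.≤ a → fromℕ ∣ a - b ∣ ≡ fromℕ a - fromℕ b
    fromℕ-∣-∣ {a} {b} b≤a = begin
      fromℕ ∣ a - b ∣                         ≡⟨ lemma (fromℕ ∣ a - b ∣) (fromℕ b) ⟩
      (fromℕ ∣ a - b ∣ + fromℕ b) - fromℕ b   ≡⟨ cong (_- fromℕ b) (fromℕ-+ ∣ a - b ∣ b) ⟨
      fromℕ (∣ a - b ∣ ℕ.+ b) - fromℕ b
        ≡⟨ cong (λ e → fromℕ e - fromℕ b) (trans (cong (ℕ._+ b) (ℕ.m≤n⇒∣n-m∣≡n∸m b≤a)) (ℕ.m∸n+n≡m b≤a)) ⟩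
      fromℕ a - fromℕ b                       ∎
      where
      open ≡-Reasoning
      lemma : ∀ x b → x ≡ (x + b) - b
      lemma = solve-∀ ℚ-ring

    -- As a function of a, the indicator of b ≤ a is a step at b. This jump is what produces the
    -- point source in the Laplacian of `cycleGreen`.
    𝟙-≤?-suc : ∀ a b → 𝟙 (b ℕ.≤? suc a) ≡ 𝟙 (b ℕ.≤? a) ℕ.+ 𝟙 (suc a ℕ.≟ b)
    𝟙-≤?-suc a b with b ℕ.≤? a
    ... | yes b≤a = trans (𝟙-yes (b ℕ.≤? suc a) (ℕ.m≤n⇒m≤1+n b≤a))
                          (sym (cong₂ ℕ._+_ (𝟙-yes (b ℕ.≤? a) b≤a)
                                            (𝟙-no (suc a ℕ.≟ b) (λ eq → ℕ.<⇒≱ (ℕ.≤-reflexive eq) b≤a))))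
    ... | no b≰a  = trans (𝟙-cong (b ℕ.≤? suc a) (suc a ℕ.≟ b)
                                  (λ b≤1+a → ℕ.≤-antisym (ℕ.≰⇒> b≰a) b≤1+a) (λ eq → ℕ.≤-reflexive (sym eq)))
                          (cong (ℕ._+ 𝟙 (suc a ℕ.≟ b)) (sym (𝟙-no (b ℕ.≤? a) b≰a)))

    private
      γ : ℚ → ℚ → ℚ
      γ q d = d * d - q * d

    -- -n times the resistance distance on the n-cycle with unit conductances, hence up to
    -- scaling a Green function of its Laplacian.
    cycleGreen : ∀ n → Fin n → Fin n → ℚ
    cycleGreen n i j = γ (fromℕ n) (fromℕ ∣ toℕ i - toℕ j ∣)

    cycleGreen-sym : (i j : Fin n) → cycleGreen n i j ≡ cycleGreen n j i
    cycleGreen-sym {n} i j = cong (λ d → γ (fromℕ n) (fromℕ d)) (ℕ.∣-∣-comm (toℕ i) (toℕ j))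

    cycleGreen-diagonal : (i : Fin n) → cycleGreen n i i ≡ 0ℚ
    cycleGreen-diagonal {n} i = trans (cong (λ d → γ (fromℕ n) (fromℕ d)) (ℕ.∣n-n∣≡0 (toℕ i))) (lemma (fromℕ n))
      where
      lemma : ∀ n → 0ℚ * 0ℚ - n * 0ℚ ≡ 0ℚ
      lemma = solve-∀ ℚ-ring

    cycleGreen-≥ : ∀ {i j : Fin n} {a b} → toℕ i ≡ a → toℕ j ≡ b → b ℕ.≤ a →
                   cycleGreen n i j ≡ γ (fromℕ n) (fromℕ a - fromℕ b)
    cycleGreen-≥ {n} refl refl b≤a = cong (γ (fromℕ n)) (fromℕ-∣-∣ b≤a)

    cycleGreen-≤ : ∀ {i j : Fin n} {a b} → toℕ i ≡ a → toℕ j ≡ b → a ℕ.≤ b →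
                   cycleGreen n i j ≡ γ (fromℕ n) (fromℕ b - fromℕ a)
    cycleGreen-≤ {n} {i} {j} p q a≤b = trans (cycleGreen-sym i j) (cycleGreen-≥ q p a≤b)

    private
      -- First difference of `cycleGreen` from i to i + 1. With l the indicator of j ≤ i, one
      -- formula serves both branches of the absolute value: it is linear in i except for a jump of
      -- 2n.
      slope : ℚ → ℚ → ℚ → ℚ → ℚ
      slope n l i j = fromℕ 2 * n * l - n - 1ℚ - fromℕ 2 * (i - j)

      -- Since `γ q d` is unchanged under d ↦ q - d, the distance may be continued past the seam,
      -- and the last step obeys the same formula. Here n is the length of the cycle minus one.
      slope-wrap : ∀ n j → γ (1ℚ + n) (n - j) - γ (1ℚ + n) (j - 0ℚ) ≡ slope (1ℚ + n) 1ℚ n j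
      slope-wrap n j = lemma n j
        where
        lemma : ∀ n j → ((n - j) * (n - j) - (1ℚ + n) * (n - j)) - ((j - 0ℚ) * (j - 0ℚ) - (1ℚ + n) * (j - 0ℚ)) ≡
                        fromℕ 2 * (1ℚ + n) * 1ℚ - (1ℚ + n) - 1ℚ - fromℕ 2 * (n - j)
        lemma = solve-∀ ℚ-ring

      slope-≥ : ∀ n i j → γ n (i - j) - γ n ((1ℚ + i) - j) ≡ slope n 1ℚ i j
      slope-≥ n i j = lemma n i j
        where
        lemma : ∀ n i j → ((i - j) * (i - j) - n * (i - j)) - (((1ℚ + i) - j) * ((1ℚ + i) - j) - n * ((1ℚ + i) - j)) ≡
                          fromℕ 2 * n * 1ℚ - n - 1ℚ - fromℕ 2 * (i - j)
        lemma = solve-∀ ℚ-ring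

      slope-< : ∀ n i j → γ n (j - i) - γ n (j - (1ℚ + i)) ≡ slope n 0ℚ i j
      slope-< n i j = lemma n i j
        where
        lemma : ∀ n i j → ((j - i) * (j - i) - n * (j - i)) - ((j - (1ℚ + i)) * (j - (1ℚ + i)) - n * (j - (1ℚ + i))) ≡
                          fromℕ 2 * n * 0ℚ - n - 1ℚ - fromℕ 2 * (i - j)
        lemma = solve-∀ ℚ-ring

      slope-wrap-difference : ∀ n j u → slope (1ℚ + n) u 0ℚ j - slope (1ℚ + n) 1ℚ n j ≡ fromℕ 2 * (1ℚ + n) * u - fromℕ 2
      slope-wrap-difference n j u = lemma n j u
        where
        lemma : ∀ n j u → (fromℕ 2 * (1ℚ + n) * u - (1ℚ + n) - 1ℚ - fromℕ 2 * (0ℚ - j)) -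
                          (fromℕ 2 * (1ℚ + n) * 1ℚ - (1ℚ + n) - 1ℚ - fromℕ 2 * (n - j)) ≡
                          fromℕ 2 * (1ℚ + n) * u - fromℕ 2
        lemma = solve-∀ ℚ-ring

      slope-difference : ∀ n l u i j → slope n (l + u) (1ℚ + i) j - slope n l i j ≡ fromℕ 2 * n * u - fromℕ 2
      slope-difference n l u i j = lemma n i j l u
        where
        lemma : ∀ n i j l u → (fromℕ 2 * n * (l + u) - n - 1ℚ - fromℕ 2 * ((1ℚ + i) - j)) -
                              (fromℕ 2 * n * l - n - 1ℚ - fromℕ 2 * (i - j)) ≡
                              fromℕ 2 * n * u - fromℕ 2
        lemma = solve-∀ ℚ-ring

    cycleGreen-step : (i j : Fin n) → cycleGreen n i j - cycleGreen n (next i) j ≡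
                      slope (fromℕ n) (fromℕ (𝟙 (toℕ j ℕ.≤? toℕ i))) (fromℕ (toℕ i)) (fromℕ (toℕ j))
    cycleGreen-step {suc n} i j = step (toℕ-next i) (toℕ j ℕ.≤? toℕ i)
      where
      open ≡-Reasoning
      N = fromℕ (suc n)
      I = fromℕ (toℕ i)
      J = fromℕ (toℕ j)
      j≤n = ℕ.≤-pred (Fin.toℕ<n j)
      step : toℕ (next i) ≡ suc (toℕ i) ⊎ (toℕ (next i) ≡ 0 × toℕ i ≡ n) → Dec (toℕ j ℕ.≤ toℕ i) →
             cycleGreen (suc n) i j - cycleGreen (suc n) (next i) j ≡ slope N (fromℕ (𝟙 (toℕ j ℕ.≤? toℕ i))) I J
      step (inj₂ (p , q)) _ = begin
        cycleGreen (suc n) i j - cycleGreen (suc n) (next i) j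
          ≡⟨ cong₂ _-_ (cycleGreen-≥ q refl j≤n) (cycleGreen-≤ p refl ℕ.z≤n) ⟩
        γ (fromℕ (suc n)) (fromℕ n - J) - γ (fromℕ (suc n)) (J - 0ℚ)
          ≡⟨ cong (λ a → γ a (fromℕ n - J) - γ a (J - 0ℚ)) (fromℕ-suc n) ⟩
        γ (1ℚ + fromℕ n) (fromℕ n - J) - γ (1ℚ + fromℕ n) (J - 0ℚ)
          ≡⟨ slope-wrap (fromℕ n) J ⟩
        slope (1ℚ + fromℕ n) 1ℚ (fromℕ n) J
          ≡⟨ cong₂ (λ a b → slope a 1ℚ (fromℕ b) J) (fromℕ-suc n) q ⟨
        slope (fromℕ (suc n)) 1ℚ (fromℕ (toℕ i)) J
          ≡⟨ cong (λ l → slope (fromℕ (suc n)) (fromℕ l) (fromℕ (toℕ i)) J)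
               (𝟙-yes (toℕ j ℕ.≤? toℕ i) (ℕ.≤-trans j≤n (ℕ.≤-reflexive (sym q)))) ⟨
        slope (fromℕ (suc n)) (fromℕ (𝟙 (toℕ j ℕ.≤? toℕ i))) (fromℕ (toℕ i)) J ∎
      step (inj₁ p) (yes j≤i) = begin
        cycleGreen (suc n) i j - cycleGreen (suc n) (next i) j
          ≡⟨ cong₂ _-_ (cycleGreen-≥ refl refl j≤i) (cycleGreen-≥ p refl (ℕ.m≤n⇒m≤1+n j≤i)) ⟩
        γ N (I - J) - γ N (fromℕ (suc (toℕ i)) - J)
          ≡⟨ cong (λ a → γ N (I - J) - γ N (a - J)) (fromℕ-suc (toℕ i)) ⟩
        γ N (I - J) - γ N ((1ℚ + I) - J)
          ≡⟨ slope-≥ N I J ⟩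
        slope N 1ℚ I J
          ≡⟨ cong (λ l → slope N (fromℕ l) I J) (𝟙-yes (toℕ j ℕ.≤? toℕ i) j≤i) ⟨
        slope N (fromℕ (𝟙 (toℕ j ℕ.≤? toℕ i))) I J ∎
      step (inj₁ p) (no j≰i) = begin
        cycleGreen (suc n) i j - cycleGreen (suc n) (next i) j
          ≡⟨ cong₂ _-_ (cycleGreen-≤ refl refl (ℕ.≰⇒≥ j≰i)) (cycleGreen-≤ p refl (ℕ.≰⇒> j≰i)) ⟩
        γ N (J - I) - γ N (J - fromℕ (suc (toℕ i)))
          ≡⟨ cong (λ a → γ N (J - I) - γ N (J - a)) (fromℕ-suc (toℕ i)) ⟩
        γ N (J - I) - γ N (J - (1ℚ + I))
          ≡⟨ slope-< N I J ⟩
        slope N 0ℚ I J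
          ≡⟨ cong (λ l → slope N (fromℕ l) I J) (𝟙-no (toℕ j ℕ.≤? toℕ i) j≰i) ⟨
        slope N (fromℕ (𝟙 (toℕ j ℕ.≤? toℕ i))) I J ∎

    -- Two consecutive slopes are compared. The linear part contributes -2, and the indicator jumps
    -- at i = j only, which contributes 2n. At vertex 0 both the linear part and the indicator are
    -- reset, and the resets compensate up to the same -2.
    cycleGreen-laplacian : (i j : Fin n) →
      (cycleGreen n i j - cycleGreen n (next i) j) - (cycleGreen n (prev i) j - cycleGreen n i j) ≡
      fromℕ 2 * fromℕ n * unit i j - fromℕ 2
    cycleGreen-laplacian {suc n} i j = begin
      (G i - G (next i)) - (G (prev i) - G i)
        ≡⟨ cong (λ k → (G i - G (next i)) - (G (prev i) - G k)) (next-prev i) ⟨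
      (G i - G (next i)) - (G (prev i) - G (next (prev i)))
        ≡⟨ cong₂ _-_ (cycleGreen-step i j) (cycleGreen-step (prev i) j) ⟩
      slope N (fromℕ (below (toℕ i))) (fromℕ (toℕ i)) J - slope N (fromℕ (below (toℕ (prev i)))) (fromℕ (toℕ (prev i))) J
        ≡⟨ difference i ⟩
      fromℕ 2 * N * unit i j - fromℕ 2 ∎
      where
      open ≡-Reasoning
      N = fromℕ (suc n)
      J = fromℕ (toℕ j)
      G : Fin (suc n) → ℚ
      G k = cycleGreen (suc n) k j
      below : ℕ → ℕ
      below a = 𝟙 (toℕ j ℕ.≤? a)
      difference : ∀ i → slope N (fromℕ (below (toℕ i))) (fromℕ (toℕ i)) J -
                         slope N (fromℕ (below (toℕ (prev i)))) (fromℕ (toℕ (prev i))) J ≡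
                         fromℕ 2 * N * unit i j - fromℕ 2
      difference zero = begin
        slope N (fromℕ (below 0)) 0ℚ J - slope N (fromℕ (below (toℕ (Fin.fromℕ n)))) (fromℕ (toℕ (Fin.fromℕ n))) J
          ≡⟨ cong₂ (λ l a → slope N (fromℕ l) 0ℚ J - slope N (fromℕ (below a)) (fromℕ a) J)
               (𝟙-cong (toℕ j ℕ.≤? 0) (zero ≟ j) (λ j≤0 → sym (Fin.toℕ-injective (ℕ.n≤0⇒n≡0 j≤0))) (λ { refl → ℕ.z≤n }))
               (Fin.toℕ-fromℕ n) ⟩
        slope N (unit zero j) 0ℚ J - slope N (fromℕ (below n)) (fromℕ n) J
          ≡⟨ cong₂ (λ a l → slope a (unit zero j) 0ℚ J - slope a (fromℕ l) (fromℕ n) J)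
               (fromℕ-suc n) (𝟙-yes (toℕ j ℕ.≤? n) (ℕ.≤-pred (Fin.toℕ<n j))) ⟩
        slope (1ℚ + fromℕ n) (unit zero j) 0ℚ J - slope (1ℚ + fromℕ n) 1ℚ (fromℕ n) J
          ≡⟨ slope-wrap-difference (fromℕ n) J (unit zero j) ⟩
        fromℕ 2 * (1ℚ + fromℕ n) * unit zero j - fromℕ 2
          ≡⟨ cong (λ a → fromℕ 2 * a * unit zero j - fromℕ 2) (fromℕ-suc n) ⟨
        fromℕ 2 * N * unit zero j - fromℕ 2 ∎
      difference (suc i) = begin
        slope N (fromℕ (below (suc (toℕ i)))) (fromℕ (suc (toℕ i))) J -
        slope N (fromℕ (below (toℕ (inject₁ i)))) (fromℕ (toℕ (inject₁ i))) J
          ≡⟨ cong₂ (λ a b → slope N (fromℕ (below (suc (toℕ i)))) a J - slope N (fromℕ (below b)) (fromℕ b) J)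
               (fromℕ-suc (toℕ i)) (Fin.toℕ-inject₁ i) ⟩
        slope N (fromℕ (below (suc (toℕ i)))) (1ℚ + I) J - slope N (fromℕ (below (toℕ i))) I J
          ≡⟨ cong (λ l → slope N l (1ℚ + I) J - slope N (fromℕ (below (toℕ i))) I J) (trans
               (cong fromℕ (trans (𝟙-≤?-suc (toℕ i) (toℕ j))
                 (cong (below (toℕ i) ℕ.+_) (𝟙-cong (suc (toℕ i) ℕ.≟ toℕ j) (suc i ≟ j) Fin.toℕ-injective (cong toℕ)))))
               (fromℕ-+ (below (toℕ i)) (𝟙 (suc i ≟ j)))) ⟩
        slope N (fromℕ (below (toℕ i)) + unit (suc i) j) (1ℚ + I) J - slope N (fromℕ (below (toℕ i))) I J
          ≡⟨ slope-difference N (fromℕ (below (toℕ i))) (unit (suc i) j) I J ⟩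
        fromℕ 2 * N * unit (suc i) j - fromℕ 2 ∎
        where I = fromℕ (toℕ i)

    cycleGreen-next : (i : Fin n) → cycleGreen n i (next i) ≡ 1ℚ - fromℕ n
    cycleGreen-next {suc n} i = step (toℕ-next i)
      where
      wrap : ∀ n → (n - 0ℚ) * (n - 0ℚ) - (1ℚ + n) * (n - 0ℚ) ≡ 1ℚ - (1ℚ + n)
      wrap = solve-∀ ℚ-ring
      inner : ∀ n i → ((1ℚ + i) - i) * ((1ℚ + i) - i) - n * ((1ℚ + i) - i) ≡ 1ℚ - n
      inner = solve-∀ ℚ-ring
      step : toℕ (next i) ≡ suc (toℕ i) ⊎ (toℕ (next i) ≡ 0 × toℕ i ≡ n) → cycleGreen (suc n) i (next i) ≡ 1ℚ - fromℕ (suc n)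
      step (inj₂ (p , q)) = trans (cycleGreen-≥ q p ℕ.z≤n)
        (trans (cong (λ a → γ a (fromℕ n - 0ℚ)) (fromℕ-suc n)) (trans (wrap (fromℕ n)) (cong (1ℚ -_) (sym (fromℕ-suc n)))))
      step (inj₁ p) = trans (cycleGreen-≤ refl p (ℕ.n≤1+n (toℕ i)))
        (trans (cong (λ a → γ (fromℕ (suc n)) (a - fromℕ (toℕ i))) (fromℕ-suc (toℕ i))) (inner (fromℕ (suc n)) (fromℕ (toℕ i))))

    -- These are the closed forms of the sums of d² and of d, times 6. The coefficient q stays free
    -- because the induction varies n, while the cycle length that will be put for q must not change
    -- inside the summand.
    ∑-quadratic : ∀ q n → let f = λ d → fromℕ d * fromℕ d - q * fromℕ d in
      fromℕ 6 * ∑[ i < n ] f (suc (toℕ i)) ≡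
      fromℕ n * (fromℕ n + 1ℚ) * (fromℕ 2 * fromℕ n + 1ℚ) - fromℕ 3 * q * fromℕ n * (fromℕ n + 1ℚ)
    ∑-quadratic q zero = lemma q
      where
      lemma : ∀ q → fromℕ 6 * 0ℚ ≡ fromℕ 0 * (fromℕ 0 + 1ℚ) * (fromℕ 2 * fromℕ 0 + 1ℚ) - fromℕ 3 * q * fromℕ 0 * (fromℕ 0 + 1ℚ)
      lemma = solve-∀ ℚ-ring
    ∑-quadratic q (suc n) = begin
      fromℕ 6 * ∑[ i < suc n ] f (suc (toℕ i))
        ≡⟨ cong (fromℕ 6 *_) (sum-init-last {n} (λ i → f (suc (toℕ i)))) ⟩
      fromℕ 6 * (∑[ i < n ] f (suc (toℕ (inject₁ i))) + f (suc (toℕ (Fin.fromℕ n))))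
        ≡⟨ cong₂ (λ a b → fromℕ 6 * (a + f (suc b))) (sum-cong-≗ {n} (λ i → cong (f ∘ suc) (Fin.toℕ-inject₁ i))) (Fin.toℕ-fromℕ n) ⟩
      fromℕ 6 * (∑[ i < n ] f (suc (toℕ i)) + f (suc n))
        ≡⟨ ℚ.*-distribˡ-+ (fromℕ 6) (∑[ i < n ] f (suc (toℕ i))) (f (suc n)) ⟩
      fromℕ 6 * ∑[ i < n ] f (suc (toℕ i)) + fromℕ 6 * f (suc n)
        ≡⟨ cong₂ _+_ (∑-quadratic q n) (cong (λ a → fromℕ 6 * (a * a - q * a)) (fromℕ-suc n)) ⟩
      _ ≡⟨ lemma q (fromℕ n) ⟩
      _ ≡⟨ cong (λ a → a * (a + 1ℚ) * (fromℕ 2 * a + 1ℚ) - fromℕ 3 * q * a * (a + 1ℚ)) (fromℕ-suc n) ⟨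
      _ ∎
      where
      open ≡-Reasoning
      f : ℕ → ℚ
      f d = fromℕ d * fromℕ d - q * fromℕ d
      lemma : ∀ q n → n * (n + 1ℚ) * (fromℕ 2 * n + 1ℚ) - fromℕ 3 * q * n * (n + 1ℚ) + fromℕ 6 * ((1ℚ + n) * (1ℚ + n) - q * (1ℚ + n)) ≡
        (1ℚ + n) * ((1ℚ + n) + 1ℚ) * (fromℕ 2 * (1ℚ + n) + 1ℚ) - fromℕ 3 * q * (1ℚ + n) * ((1ℚ + n) + 1ℚ)
      lemma = solve-∀ ℚ-ring

    -- Removing row 0 and column 0 from the table of distances leaves the same table one size
    -- smaller, as the distance is unchanged when both indices drop by one. Outside the corner, row
    -- and column each carry the distances 1 to n, whence the factor 2 on the single sum.
    ∑∑-quadratic : ∀ q n → let f = λ d → fromℕ d * fromℕ d - q * fromℕ d in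
      fromℕ 6 * ∑[ i < n ] ∑[ j < n ] f ∣ toℕ i - toℕ j ∣ ≡
      fromℕ n * (fromℕ n * fromℕ n - 1ℚ) * (fromℕ n - fromℕ 2 * q)
    ∑∑-quadratic q zero = lemma q
      where
      lemma : ∀ q → fromℕ 6 * 0ℚ ≡ fromℕ 0 * (fromℕ 0 * fromℕ 0 - 1ℚ) * (fromℕ 0 - fromℕ 2 * q)
      lemma = solve-∀ ℚ-ring
    ∑∑-quadratic q (suc n) = begin
      fromℕ 6 * (f 0 + s + ∑[ i < n ] (f (suc (toℕ i)) + ∑[ j < n ] f ∣ toℕ i - toℕ j ∣))
        ≡⟨ cong (λ a → fromℕ 6 * (f 0 + s + a)) (∑-distrib-+ {n} (λ i → f (suc (toℕ i))) (λ i → ∑[ j < n ] f ∣ toℕ i - toℕ j ∣)) ⟩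
      fromℕ 6 * (f 0 + s + (s + t))
        ≡⟨ lemma₁ q s t ⟩
      fromℕ 2 * (fromℕ 6 * s) + fromℕ 6 * t
        ≡⟨ cong₂ (λ a b → fromℕ 2 * a + b) (∑-quadratic q n) (∑∑-quadratic q n) ⟩
      _ ≡⟨ lemma₂ q (fromℕ n) ⟩
      _ ≡⟨ cong (λ a → a * (a * a - 1ℚ) * (a - fromℕ 2 * q)) (fromℕ-suc n) ⟨
      _ ∎
      where
      open ≡-Reasoning
      f : ℕ → ℚ
      f d = fromℕ d * fromℕ d - q * fromℕ d
      s = ∑[ i < n ] f (suc (toℕ i))
      t = ∑[ i < n ] ∑[ j < n ] f ∣ toℕ i - toℕ j ∣
      lemma₁ : ∀ q s t → fromℕ 6 * ((0ℚ * 0ℚ - q * 0ℚ) + s + (s + t)) ≡ fromℕ 2 * (fromℕ 6 * s) + fromℕ 6 * t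
      lemma₁ = solve-∀ ℚ-ring
      lemma₂ : ∀ q n →
        fromℕ 2 * (n * (n + 1ℚ) * (fromℕ 2 * n + 1ℚ) - fromℕ 3 * q * n * (n + 1ℚ)) + n * (n * n - 1ℚ) * (n - fromℕ 2 * q)
        ≡ (1ℚ + n) * ((1ℚ + n) * (1ℚ + n) - 1ℚ) * ((1ℚ + n) - fromℕ 2 * q)
      lemma₂ = solve-∀ ℚ-ring

    ∑∑-cycleGreen : ∀ n → fromℕ 6 * ∑[ i < n ] ∑[ j < n ] cycleGreen n i j ≡
                    ℚ.- (fromℕ n * fromℕ n * (fromℕ n * fromℕ n - 1ℚ))
    ∑∑-cycleGreen n = trans (∑∑-quadratic (fromℕ n) n) (lemma (fromℕ n))
      where
      lemma : ∀ n → n * (n * n - 1ℚ) * (n - fromℕ 2 * n) ≡ ℚ.- (n * n * (n * n - 1ℚ))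
      lemma = solve-∀ ℚ-ring

  open Cycle

  fromℕ-𝟙-¬ : {A : Set} (a? : Dec A) → fromℕ (𝟙 (¬? a?)) ≡ 1ℚ - fromℕ (𝟙 a?)
  fromℕ-𝟙-¬ (yes _) = refl
  fromℕ-𝟙-¬ (no  _) = refl

  -- The flower as a union of n copies, and its Laplacian as a sum over them.

  module Flower {n r : ℕ} (3≤n : 3 ℕ.≤ n) {x y : Fin (suc (suc r))} (x≢y : x ≢ y) where

    m : ℕ
    m = suc (suc r)

    N : ℕ
    N = n ℕ.* suc r

    F : Graph N
    F = flower 3≤n (complete m) x≢y
    open Graph F

    vertexIn : Fin n → Fin m → Fin N
    vertexIn c a = glue x≢y (c , a)

    xᵖ : Fin (suc r)
    xᵖ = punchOut (x≢y ∘ sym)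

    hub : Fin n → Fin N
    hub c = combine c xᵖ

    petal : Fin n → Fin r → Fin N
    petal c s = combine c (punchIn xᵖ s)

    inner : Fin r → Fin m
    inner s = punchIn y (punchIn xᵖ s)

    glue-punchIn : ∀ c p → vertexIn c (punchIn y p) ≡ combine c p
    glue-punchIn c p = trans (cong (glue x≢y) (sym (section-combine y c p))) (glue-section {n} x≢y (combine c p))

    glue-x : ∀ c → vertexIn c x ≡ hub c
    glue-x c = trans (cong (vertexIn c) (sym (Fin.punchIn-punchOut (x≢y ∘ sym)))) (glue-punchIn c xᵖ)

    glue-y : ∀ c → vertexIn c y ≡ hub (next c)
    glue-y c = trans (glue-identified x≢y (identify c)) (glue-x (next c))

    glue-inner : ∀ c s → vertexIn c (inner s) ≡ petal c s
    glue-inner c s = glue-punchIn c (punchIn xᵖ s)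

    -- `glue` leaves every vertex but y in the block of its own copy and sends y to the position of
    -- x in the next block. Images from different copies can thus meet only if exactly one of the
    -- two vertices is y, and the other is then x.
    glue-shared : ∀ {c c′ a a′} → c ≢ c′ → vertexIn c a ≡ vertexIn c′ a′ →
                  (a ≡ y × a′ ≡ x × next c ≡ c′) ⊎ (a ≡ x × a′ ≡ y × next c′ ≡ c)
    glue-shared {c} {c′} {a} {a′} c≢c′ eq with y ≟ a | y ≟ a′
    ... | yes _   | yes _    = ⊥-elim (c≢c′ (next-injective (proj₁ (Fin.combine-injective (next c) _ (next c′) _ eq))))
    ... | yes y≡a | no y≢a′  = inj₁ (sym y≡a , sym (Fin.punchOut-injective (x≢y ∘ sym) y≢a′ q) , p)
      where
      p = proj₁ (Fin.combine-injective (next c) _ c′ _ eq)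
      q = proj₂ (Fin.combine-injective (next c) _ c′ _ eq)
    ... | no y≢a  | yes y≡a′ = inj₂ (Fin.punchOut-injective y≢a (x≢y ∘ sym) q , sym y≡a′ , sym p)
      where
      p = proj₁ (Fin.combine-injective c _ (next c′) _ eq)
      q = proj₂ (Fin.combine-injective c _ (next c′) _ eq)
    ... | no _    | no _     = ⊥-elim (c≢c′ (proj₁ (Fin.combine-injective c _ c′ _ eq)))

    -- If two copies shared both ends of an edge, then either both ends would be y, or both x, in
    -- the first copy and so coincide, or each copy would be the successor of the other.
    edge-copy-unique : ∀ {c c′ a a′ b b′} → a ≢ b → vertexIn c a ≡ vertexIn c′ a′ → vertexIn c b ≡ vertexIn c′ b′ → c ≡ c′
    edge-copy-unique {c} {c′} a≢b p q with c ≟ c′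
    ... | yes c≡c′ = c≡c′
    ... | no c≢c′ with glue-shared c≢c′ p | glue-shared c≢c′ q
    ...   | inj₁ (a≡y , _) | inj₁ (b≡y , _) = ⊥-elim (a≢b (trans a≡y (sym b≡y)))
    ...   | inj₂ (a≡x , _) | inj₂ (b≡x , _) = ⊥-elim (a≢b (trans a≡x (sym b≡x)))
    ...   | inj₁ (_ , _ , s) | inj₂ (_ , _ , t) = ⊥-elim (next²-≢ 3≤n c (trans (cong next s) t))
    ...   | inj₂ (_ , _ , s) | inj₁ (_ , _ , t) = ⊥-elim (next²-≢ 3≤n c (trans (cong next t) s))

    vertexIn-injective : ∀ {c a a′} → vertexIn c a ≡ vertexIn c a′ → a ≡ a′
    vertexIn-injective {c} = glue-injective-in-copy x≢y (ℕ.≤-trans (ℕ.n≤1+n 2) 3≤n) c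

    -- Witnesses are unique at each of the three nested existentials: the copy by
    -- `edge-copy-unique`, the two representatives because `glue` is injective on a copy.
    𝟙-adj : ∀ u w → fromℕ (𝟙 (adj? u w)) ≡
            ∑[ c < n ] ∑[ a < m ] ∑[ b < m ] ((1ℚ - unit a b) * (unit (vertexIn c a) u * unit (vertexIn c b) w))
    𝟙-adj u w = trans (fromℕ-𝟙-any edge₁? unique₁)
      (sum-cong-≗ (λ c → trans (fromℕ-𝟙-any (edge₂? c) unique₂)
        (sum-cong-≗ (λ a → trans (fromℕ-𝟙-any (edge? c a) unique₃)
          (sum-cong-≗ (term c a))))))
      where
      open ≡-Reasoning
      edge? : ∀ c a b → Dec (a ≢ b × vertexIn c a ≡ u × vertexIn c b ≡ w)
      edge? c a b = ¬? (a ≟ b) ×-dec (vertexIn c a ≟ u) ×-dec (vertexIn c b ≟ w)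
      edge₂? : ∀ c a → Dec (∃ λ b → a ≢ b × vertexIn c a ≡ u × vertexIn c b ≡ w)
      edge₂? c a = any? (edge? c a)
      edge₁? : ∀ c → Dec (∃ λ a → ∃ λ b → a ≢ b × vertexIn c a ≡ u × vertexIn c b ≡ w)
      edge₁? c = any? (edge₂? c)
      unique₁ : ∀ {c c′} → (∃ λ a → ∃ λ b → a ≢ b × vertexIn c a ≡ u × vertexIn c b ≡ w) →
                (∃ λ a → ∃ λ b → a ≢ b × vertexIn c′ a ≡ u × vertexIn c′ b ≡ w) → c ≡ c′
      unique₁ (_ , _ , a≢b , p , q) (_ , _ , _ , p′ , q′) = edge-copy-unique a≢b (trans p (sym p′)) (trans q (sym q′))
      unique₂ : ∀ {c a a′} → (∃ λ b → a ≢ b × vertexIn c a ≡ u × vertexIn c b ≡ w) →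
                (∃ λ b → a′ ≢ b × vertexIn c a′ ≡ u × vertexIn c b ≡ w) → a ≡ a′
      unique₂ (_ , _ , p , _) (_ , _ , p′ , _) = vertexIn-injective (trans p (sym p′))
      unique₃ : ∀ {c a b b′} → a ≢ b × vertexIn c a ≡ u × vertexIn c b ≡ w →
                a ≢ b′ × vertexIn c a ≡ u × vertexIn c b′ ≡ w → b ≡ b′
      unique₃ (_ , _ , q) (_ , _ , q′) = vertexIn-injective (trans q (sym q′))
      term : ∀ c a b → fromℕ (𝟙 (edge? c a b)) ≡ (1ℚ - unit a b) * (unit (vertexIn c a) u * unit (vertexIn c b) w)
      term c a b = begin
        fromℕ (𝟙 (edge? c a b))
          ≡⟨ cong fromℕ (trans (𝟙-× (¬? (a ≟ b)) ((vertexIn c a ≟ u) ×-dec (vertexIn c b ≟ w)))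
               (cong (𝟙 (¬? (a ≟ b)) ℕ.*_) (𝟙-× (vertexIn c a ≟ u) (vertexIn c b ≟ w)))) ⟩
        fromℕ (𝟙 (¬? (a ≟ b)) ℕ.* (𝟙 (vertexIn c a ≟ u) ℕ.* 𝟙 (vertexIn c b ≟ w)))
          ≡⟨ trans (fromℕ-* (𝟙 (¬? (a ≟ b))) (𝟙 (vertexIn c a ≟ u) ℕ.* 𝟙 (vertexIn c b ≟ w)))
               (cong₂ _*_ (fromℕ-𝟙-¬ (a ≟ b)) (fromℕ-* (𝟙 (vertexIn c a ≟ u)) (𝟙 (vertexIn c b ≟ w)))) ⟩
        (1ℚ - unit a b) * (unit (vertexIn c a) u * unit (vertexIn c b) w) ∎

    copySum : (Fin N → ℚ) → Fin n → ℚ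
    copySum f c = ∑[ a < m ] f (vertexIn c a)

    -- A vertex is treated as the collection of pairs (c, a) glued to it, two for a hub and one for
    -- an inner vertex. Rows of the adjacency matrix and of the Laplacian then become termwise
    -- expressions in the copies.
    incidence : Fin N → (Fin n → Fin m → ℚ) → ℚ
    incidence u R = ∑[ c < n ] ∑[ a < m ] (unit (vertexIn c a) u * R c a)

    incidence-cong : ∀ u {R R′ : Fin n → Fin m → ℚ} → (∀ c a → R c a ≡ R′ c a) → incidence u R ≡ incidence u R′
    incidence-cong u e = sum-cong-≗ (λ c → sum-cong-≗ (λ a → cong (unit (vertexIn c a) u *_) (e c a)))

    incidence-linear : ∀ u s (R S : Fin n → Fin m → ℚ) →
                       incidence u R * s - incidence u S ≡ incidence u (λ c a → R c a * s - S c a)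
    incidence-linear u s R S = begin
      incidence u R * s - incidence u S
        ≡⟨ cong (_- incidence u S) (trans (*-distribʳ-sum s (λ c → ∑[ a < m ] (unit (vertexIn c a) u * R c a)))
             (sum-cong-≗ (λ c → *-distribʳ-sum s (λ a → unit (vertexIn c a) u * R c a)))) ⟩
      ∑[ c < n ] ∑[ a < m ] (unit (vertexIn c a) u * R c a * s) - incidence u S
        ≡⟨ ∑-distrib-- (λ c → ∑[ a < m ] (unit (vertexIn c a) u * R c a * s)) (λ c → ∑[ a < m ] (unit (vertexIn c a) u * S c a)) ⟨
      ∑[ c < n ] (∑[ a < m ] (unit (vertexIn c a) u * R c a * s) - ∑[ a < m ] (unit (vertexIn c a) u * S c a))
        ≡⟨ sum-cong-≗ (λ c → trans (sym (∑-distrib-- (λ a → unit (vertexIn c a) u * R c a * s) (λ a → unit (vertexIn c a) u * S c a)))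
             (sum-cong-≗ (λ a → lemma (unit (vertexIn c a) u) (R c a) s (S c a)))) ⟩
      incidence u (λ c a → R c a * s - S c a) ∎
      where
      open ≡-Reasoning
      lemma : ∀ e r s t → e * r * s - e * t ≡ e * (r * s - t)
      lemma = solve-∀ ℚ-ring

    adj-apply : ∀ u (f : Fin N → ℚ) → ∑[ w < N ] (fromℕ (𝟙 (adj? u w)) * f w) ≡
                incidence u (λ c a → copySum f c - f (vertexIn c a))
    adj-apply u f = begin
      ∑[ w < N ] (fromℕ (𝟙 (adj? u w)) * f w)
        ≡⟨ sum-cong-≗ (λ w → trans (cong (_* f w) (𝟙-adj u w)) (trans (*-distribʳ-sum (f w) (λ c → ∑[ a < m ] ∑[ b < m ] e c a b w))
             (sum-cong-≗ (λ c → trans (*-distribʳ-sum (f w) (λ a → ∑[ b < m ] e c a b w))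
               (sum-cong-≗ (λ a → *-distribʳ-sum (f w) (λ b → e c a b w))))))) ⟩
      ∑[ w < N ] ∑[ c < n ] ∑[ a < m ] ∑[ b < m ] (e c a b w * f w)
        ≡⟨ ∑-comm (λ w c → ∑[ a < m ] ∑[ b < m ] (e c a b w * f w)) ⟩
      ∑[ c < n ] ∑[ w < N ] ∑[ a < m ] ∑[ b < m ] (e c a b w * f w)
        ≡⟨ sum-cong-≗ (λ c → trans (∑-comm (λ w a → ∑[ b < m ] (e c a b w * f w)))
             (sum-cong-≗ (λ a → trans (∑-comm (λ w b → e c a b w * f w)) (row c a)))) ⟩
      incidence u (λ c a → copySum f c - f (vertexIn c a)) ∎
      where
      open ≡-Reasoning
      e : Fin n → Fin m → Fin m → Fin N → ℚ
      e c a b w = (1ℚ - unit a b) * (unit (vertexIn c a) u * unit (vertexIn c b) w)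
      lemma₁ : ∀ d p q f → d * (p * q) * f ≡ p * d * (q * f)
      lemma₁ = solve-∀ ℚ-ring
      lemma₂ : ∀ p d g → p * (1ℚ - d) * g ≡ p * (g - d * g)
      lemma₂ = solve-∀ ℚ-ring
      row : ∀ c a → ∑[ b < m ] ∑[ w < N ] (e c a b w * f w) ≡ unit (vertexIn c a) u * (copySum f c - f (vertexIn c a))
      row c a = begin
        ∑[ b < m ] ∑[ w < N ] (e c a b w * f w)
          ≡⟨ sum-cong-≗ (λ b → trans (sum-cong-≗ (λ w → lemma₁ (1ℚ - unit a b) (unit (vertexIn c a) u) (unit (vertexIn c b) w) (f w)))
               (trans (sym (*-distribˡ-sum (unit (vertexIn c a) u * (1ℚ - unit a b)) (λ w → unit (vertexIn c b) w * f w)))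
                      (cong (unit (vertexIn c a) u * (1ℚ - unit a b) *_) (∑-unit (vertexIn c b) f)))) ⟩
        ∑[ b < m ] (unit (vertexIn c a) u * (1ℚ - unit a b) * f (vertexIn c b))
          ≡⟨ sum-cong-≗ (λ b → lemma₂ (unit (vertexIn c a) u) (unit a b) (f (vertexIn c b))) ⟩
        ∑[ b < m ] (unit (vertexIn c a) u * (f (vertexIn c b) - unit a b * f (vertexIn c b)))
          ≡⟨ *-distribˡ-sum (unit (vertexIn c a) u) (λ b → f (vertexIn c b) - unit a b * f (vertexIn c b)) ⟨
        unit (vertexIn c a) u * ∑[ b < m ] (f (vertexIn c b) - unit a b * f (vertexIn c b))
          ≡⟨ cong (unit (vertexIn c a) u *_) (trans (∑-distrib-- (λ b → f (vertexIn c b)) (λ b → unit a b * f (vertexIn c b)))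
               (cong (copySum f c -_) (∑-unit a (λ b → f (vertexIn c b))))) ⟩
        unit (vertexIn c a) u * (copySum f c - f (vertexIn c a)) ∎

    fromℕ-degree : ∀ u → fromℕ (degree F u) ≡ incidence u (λ _ _ → fromℕ m - 1ℚ)
    fromℕ-degree u = begin
      fromℕ (degree F u)                            ≡⟨ ∑-fromℕ (λ w → 𝟙 (adj? u w)) ⟩
      ∑[ w < N ] fromℕ (𝟙 (adj? u w))               ≡⟨ sum-cong-≗ (λ w → sym (ℚ.*-identityʳ (fromℕ (𝟙 (adj? u w))))) ⟩
      ∑[ w < N ] (fromℕ (𝟙 (adj? u w)) * 1ℚ)        ≡⟨ adj-apply u (λ _ → 1ℚ) ⟩
      incidence u (λ _ _ → ∑[ b < m ] 1ℚ - 1ℚ)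
        ≡⟨ incidence-cong u (λ _ _ → cong (_- 1ℚ) (trans (∑-const m 1ℚ) (ℚ.*-identityʳ (fromℕ m)))) ⟩
      incidence u (λ _ _ → fromℕ m - 1ℚ)            ∎
      where open ≡-Reasoning

    -- Each occurrence of u in a copy contributes a row of m I - J, the Laplacian of the complete
    -- graph. The degree splits in the same way, as m - 1 per occurrence.
    laplacian-flower : ∀ u (f : Fin N → ℚ) → ∑[ w < N ] (laplacian F u w * f w) ≡
                       incidence u (λ c a → fromℕ m * f (vertexIn c a) - copySum f c)
    laplacian-flower u f = begin
      ∑[ w < N ] (laplacian F u w * f w)
        ≡⟨ laplacian-apply F u f ⟩
      fromℕ (degree F u) * f u - ∑[ w < N ] (fromℕ (𝟙 (adj? u w)) * f w)
        ≡⟨ cong₂ (λ a b → a * f u - b) (fromℕ-degree u) (adj-apply u f) ⟩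
      incidence u (λ _ _ → fromℕ m - 1ℚ) * f u - incidence u (λ c a → copySum f c - f (vertexIn c a))
        ≡⟨ incidence-linear u (f u) (λ _ _ → fromℕ m - 1ℚ) (λ c a → copySum f c - f (vertexIn c a)) ⟩
      incidence u (λ c a → (fromℕ m - 1ℚ) * f u - (copySum f c - f (vertexIn c a)))
        ≡⟨ sum-cong-≗ (λ c → sum-cong-≗ (λ a → localise c a)) ⟩
      incidence u (λ c a → fromℕ m * f (vertexIn c a) - copySum f c) ∎
      where
      open ≡-Reasoning
      lemma : ∀ k f s → (k - 1ℚ) * f - (s - f) ≡ k * f - s
      lemma = solve-∀ ℚ-ring
      -- The degree term carries the value at u, the rest the values in copy c; the indicator that
      -- (c, a) is glued to u allows them to be identified.
      localise : ∀ c a → unit (vertexIn c a) u * ((fromℕ m - 1ℚ) * f u - (copySum f c - f (vertexIn c a))) ≡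
                         unit (vertexIn c a) u * (fromℕ m * f (vertexIn c a) - copySum f c)
      localise c a = trans
        (unit-transport (vertexIn c a) u (λ w → (fromℕ m - 1ℚ) * f w - (copySum f c - f (vertexIn c a))))
        (cong (unit (vertexIn c a) u *_) (lemma (fromℕ m) (f (vertexIn c a)) (copySum f c)))

    ∑-degree : (f : Fin N → ℚ) → ∑[ u < N ] (fromℕ (degree F u) * f u) ≡ (fromℕ m - 1ℚ) * ∑[ c < n ] copySum f c
    ∑-degree f = begin
      ∑[ u < N ] (fromℕ (degree F u) * f u)
        ≡⟨ sum-cong-≗ (λ u → trans (cong (_* f u) (fromℕ-degree u))
             (trans (*-distribʳ-sum (f u) (λ c → ∑[ a < m ] (unit (vertexIn c a) u * k)))
               (sum-cong-≗ (λ c → trans (*-distribʳ-sum (f u) (λ a → unit (vertexIn c a) u * k))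
                 (sum-cong-≗ (λ a → lemma (unit (vertexIn c a) u) k (f u))))))) ⟩
      ∑[ u < N ] ∑[ c < n ] ∑[ a < m ] (k * (unit (vertexIn c a) u * f u))
        ≡⟨ ∑-comm (λ u c → ∑[ a < m ] (k * (unit (vertexIn c a) u * f u))) ⟩
      ∑[ c < n ] ∑[ u < N ] ∑[ a < m ] (k * (unit (vertexIn c a) u * f u))
        ≡⟨ sum-cong-≗ (λ c → trans (∑-comm (λ u a → k * (unit (vertexIn c a) u * f u)))
             (trans (sum-cong-≗ (λ a → trans (sym (*-distribˡ-sum k (λ u → unit (vertexIn c a) u * f u)))
                                             (cong (k *_) (∑-unit (vertexIn c a) f))))
                    (sym (*-distribˡ-sum k (λ a → f (vertexIn c a)))))) ⟩
      ∑[ c < n ] (k * copySum f c)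
        ≡⟨ *-distribˡ-sum k (copySum f) ⟨
      k * ∑[ c < n ] copySum f c ∎
      where
      open ≡-Reasoning
      k = fromℕ m - 1ℚ
      lemma : ∀ e k f → e * k * f ≡ k * (e * f)
      lemma = solve-∀ ℚ-ring

    ∑-copy : (g : Fin m → ℚ) → sum g ≡ g y + (g x + ∑[ s < r ] g (inner s))
    ∑-copy g = trans (sum-remove {i = y} g) (cong (g y +_) (trans (sum-remove {i = xᵖ} (g ∘ punchIn y))
      (cong (λ a → g a + ∑[ s < r ] g (inner s)) (Fin.punchIn-punchOut (x≢y ∘ sym)))))

    copySum-expand : ∀ f c → copySum f c ≡ f (hub (next c)) + (f (hub c) + ∑[ s < r ] f (petal c s))
    copySum-expand f c = trans (∑-copy (λ a → f (vertexIn c a)))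
      (cong₂ _+_ (cong f (glue-y c)) (cong₂ _+_ (cong f (glue-x c)) (sum-cong-≗ (λ s → cong f (glue-inner c s)))))

    incidence-expand : ∀ u R → incidence u R ≡
      ∑[ c < n ] (unit (hub (next c)) u * R c y) +
        (∑[ c < n ] (unit (hub c) u * R c x) + ∑[ c < n ] ∑[ s < r ] (unit (petal c s) u * R c (inner s)))
    incidence-expand u R = begin
      incidence u R
        ≡⟨ sum-cong-≗ (λ c → trans (∑-copy (λ a → unit (vertexIn c a) u * R c a))
             (cong₂ _+_ (cong (λ w → unit w u * R c y) (glue-y c))
               (cong₂ _+_ (cong (λ w → unit w u * R c x) (glue-x c))
                 (sum-cong-≗ (λ s → cong (λ w → unit w u * R c (inner s)) (glue-inner c s)))))) ⟩
      ∑[ c < n ] (p c + (q c + t c))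
        ≡⟨ trans (∑-distrib-+ p (λ c → q c + t c)) (cong (sum p +_) (∑-distrib-+ q t)) ⟩
      sum p + (sum q + sum t) ∎
      where
      open ≡-Reasoning
      p q t : Fin n → ℚ
      p c = unit (hub (next c)) u * R c y
      q c = unit (hub c) u * R c x
      t c = ∑[ s < r ] (unit (petal c s) u * R c (inner s))

    unit-hub-hub : ∀ c i → unit (hub c) (hub i) ≡ unit i c
    unit-hub-hub c i = cong fromℕ (𝟙-cong (hub c ≟ hub i) (i ≟ c)
      (λ e → sym (Fin.combine-injectiveˡ c xᵖ i xᵖ e)) (λ e → cong hub (sym e)))

    unit-hub-petal : ∀ c i s → unit (hub c) (petal i s) ≡ 0ℚ
    unit-hub-petal c i s = cong fromℕ (𝟙-no (hub c ≟ petal i s)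
      (λ e → Fin.punchInᵢ≢i xᵖ s (sym (Fin.combine-injectiveʳ c xᵖ i (punchIn xᵖ s) e))))

    unit-petal-hub : ∀ c s i → unit (petal c s) (hub i) ≡ 0ℚ
    unit-petal-hub c s i = trans (unit-sym (petal c s) (hub i)) (unit-hub-petal i c s)

    unit-petal-petal : ∀ c s i t → unit (petal c s) (petal i t) ≡ unit i c * unit t s
    unit-petal-petal c s i t = trans (cong fromℕ (trans
      (𝟙-cong (petal c s ≟ petal i t) ((i ≟ c) ×-dec (t ≟ s))
        (λ e → sym (Fin.combine-injectiveˡ c _ i _ e) , sym (Fin.punchIn-injective xᵖ s t (Fin.combine-injectiveʳ c _ i _ e)))
        (λ (p , q) → cong₂ petal (sym p) (sym q)))
      (𝟙-× (i ≟ c) (t ≟ s)))) (fromℕ-* (𝟙 (i ≟ c)) (𝟙 (t ≟ s)))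

    private
      ∑-0* : ∀ {k} (e g : Fin k → ℚ) → (∀ i → e i ≡ 0ℚ) → ∑[ i < k ] (e i * g i) ≡ 0ℚ
      ∑-0* {k} e g z = trans (sum-cong-≗ (λ i → trans (cong (_* g i) (z i)) (ℚ.*-zeroˡ (g i)))) (sum-replicate-zero k)

    incidence-hub : ∀ i R → incidence (hub i) R ≡ R (prev i) y + R i x
    incidence-hub i R = begin
      incidence (hub i) R
        ≡⟨ incidence-expand (hub i) R ⟩
      _ ≡⟨ cong₂ _+_ at-y (cong₂ _+_ at-x at-inner) ⟩
      R (prev i) y + (R i x + 0ℚ)
        ≡⟨ cong (R (prev i) y +_) (ℚ.+-identityʳ (R i x)) ⟩
      R (prev i) y + R i x ∎
      where
      open ≡-Reasoning
      at-y : ∑[ c < n ] (unit (hub (next c)) (hub i) * R c y) ≡ R (prev i) y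
      -- The condition on `next c` is moved to `prev i`, so that the indicator selects a value of c
      -- itself.
      at-y = trans (sum-cong-≗ (λ c → cong (_* R c y) (trans (unit-hub-hub (next c) i)
               (sym (unit-prev i c)))))
               (∑-unit (prev i) (λ c → R c y))
      at-x : ∑[ c < n ] (unit (hub c) (hub i) * R c x) ≡ R i x
      at-x = trans (sum-cong-≗ (λ c → cong (_* R c x) (unit-hub-hub c i))) (∑-unit i (λ c → R c x))
      at-inner : ∑[ c < n ] ∑[ s < r ] (unit (petal c s) (hub i) * R c (inner s)) ≡ 0ℚ
      at-inner = trans (sum-cong-≗ (λ c → ∑-0* (λ s → unit (petal c s) (hub i)) (λ s → R c (inner s)) (λ s → unit-petal-hub c s i)))
                       (sum-replicate-zero n)

    incidence-petal : ∀ i t R → incidence (petal i t) R ≡ R i (inner t)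
    incidence-petal i t R = begin
      incidence (petal i t) R
        ≡⟨ incidence-expand (petal i t) R ⟩
      _ ≡⟨ cong₂ _+_ (∑-0* (λ c → unit (hub (next c)) (petal i t)) (λ c → R c y) (λ c → unit-hub-petal (next c) i t))
             (cong₂ _+_ (∑-0* (λ c → unit (hub c) (petal i t)) (λ c → R c x) (λ c → unit-hub-petal c i t)) at-inner) ⟩
      0ℚ + (0ℚ + R i (inner t))
        ≡⟨ trans (ℚ.+-identityˡ _) (ℚ.+-identityˡ (R i (inner t))) ⟩
      R i (inner t) ∎
      where
      open ≡-Reasoning
      at-inner : ∑[ c < n ] ∑[ s < r ] (unit (petal c s) (petal i t) * R c (inner s)) ≡ R i (inner t)
      at-inner = begin
        ∑[ c < n ] ∑[ s < r ] (unit (petal c s) (petal i t) * R c (inner s))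
          ≡⟨ sum-cong-≗ (λ c → trans (sum-cong-≗ (λ s → trans (cong (_* R c (inner s)) (unit-petal-petal c s i t))
               (ℚ.*-assoc (unit i c) (unit t s) (R c (inner s)))))
               (trans (sym (*-distribˡ-sum (unit i c) (λ s → unit t s * R c (inner s))))
                      (cong (unit i c *_) (∑-unit t (λ s → R c (inner s)))))) ⟩
        ∑[ c < n ] (unit i c * R c (inner t))
          ≡⟨ ∑-unit i (λ c → R c (inner t)) ⟩
        R i (inner t) ∎

  -- The Green matrix of the flower and Kirchhoff's equations for it.

  module FlowerGreen {n′ r : ℕ} (3≤n : 3 ℕ.≤ suc n′) {x y : Fin (suc (suc r))} (x≢y : x ≢ y) where

    open Flower 3≤n x≢y
    open Graph F

    n : ℕ
    n = suc n′

    private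
      nℚ mℚ rℚ : ℚ
      nℚ = fromℕ n
      mℚ = fromℕ m
      rℚ = fromℕ r

      mℚ≡ : mℚ ≡ fromℕ 2 + rℚ
      mℚ≡ = fromℕ-+ 2 r

    -- The hub of copy c is (c , nothing); its inner vertices are (c , just s).
    Place : Set
    Place = Fin n × Maybe (Fin r)

    vertex : Place → Fin N
    vertex (c , nothing) = hub c
    vertex (c , just s)  = petal c s

    position : Fin (suc r) → Maybe (Fin r)
    position p with xᵖ ≟ p
    ... | yes _  = nothing
    ... | no x≢p = just (punchOut x≢p)

    place : Fin N → Place
    place u = proj₁ (remQuot {n} (suc r) u) , position (proj₂ (remQuot {n} (suc r) u))

    vertex-position : ∀ c p → vertex (c , position p) ≡ combine c p
    vertex-position c p with xᵖ ≟ p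
    ... | yes x≡p = cong (combine c) x≡p
    ... | no x≢p  = cong (combine c) (Fin.punchIn-punchOut x≢p)

    vertex-place : ∀ u → vertex (place u) ≡ u
    vertex-place u = trans (vertex-position (proj₁ (remQuot {n} (suc r) u)) (proj₂ (remQuot {n} (suc r) u)))
                           (Fin.combine-remQuot {n} (suc r) u)

    position-hub : position xᵖ ≡ nothing
    position-hub with xᵖ ≟ xᵖ
    ... | yes _  = refl
    ... | no x≢x = ⊥-elim (x≢x refl)

    position-petal : ∀ s → position (punchIn xᵖ s) ≡ just s
    position-petal s with xᵖ ≟ punchIn xᵖ s
    ... | yes eq = ⊥-elim (Fin.punchInᵢ≢i xᵖ s (sym eq))
    ... | no neq = cong just (trans (Fin.punchOut-cong xᵖ refl) (Fin.punchOut-punchIn xᵖ))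

    place-combine : ∀ c p → place (combine c p) ≡ (c , position p)
    place-combine c p = cong (λ q → proj₁ q , position (proj₂ q)) (Fin.remQuot-combine {n} c p)

    place-vertex : ∀ a → place (vertex a) ≡ a
    place-vertex (c , nothing) = trans (place-combine c xᵖ) (cong (c ,_) position-hub)
    place-vertex (c , just s)  = trans (place-combine c (punchIn xᵖ s)) (cong (c ,_) (position-petal s))

    copy-edge : ∀ c {a b} → a ≢ b → Adj (vertexIn c a) (vertexIn c b)
    copy-edge c a≢b = c , _ , _ , a≢b , refl , refl

    hub-hub : ∀ c → Adj (hub c) (hub (next c))
    hub-hub c = subst₂ Adj (glue-x c) (glue-y c) (copy-edge c x≢y)

    hub-petal : ∀ c s → Adj (hub c) (petal c s)
    hub-petal c s = subst₂ Adj (glue-x c) (glue-inner c s) (copy-edge c x≢inner)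
      where
      x≢inner : x ≢ inner s
      x≢inner eq = Fin.punchInᵢ≢i xᵖ s
        (sym (Fin.punchIn-injective y xᵖ (punchIn xᵖ s) (trans (Fin.punchIn-punchOut (x≢y ∘ sym)) eq)))

    connected : Connected F
    connected u v = Star.reverse adj-sym (from-root u) ◅◅ from-root v
      where
      root : Fin N
      root = hub zero
      -- The path runs through the hubs in increasing order and never crosses the seam, so `next`
      -- acts here as the plain successor.
      to-hub : ∀ c → Star Adj root (hub c)
      to-hub = <-weakInduction (λ c → Star Adj root (hub c)) ε
        (λ i p → p ◅◅ (subst (Adj (hub (inject₁ i)) ∘ hub) (next-inject₁ i) (hub-hub (inject₁ i)) ◅ ε))
      to-vertex : ∀ a → Star Adj root (vertex a)
      to-vertex (c , nothing) = to-hub c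
      to-vertex (c , just s)  = to-hub c ◅◅ (hub-petal c s ◅ ε)
      from-root : ∀ w → Star Adj root w
      from-root w = subst (Star Adj root) (vertex-place w) (to-vertex (place w))

    private
      G : Fin n → Fin n → ℚ
      G = cycleGreen n

    -- The two hubs between which a current at the place is divided in halves. For a hub both are
    -- the hub itself, so that one formula for `green` covers hubs and inner vertices.
    entry exit : Place → Fin n
    entry (c , _)       = c
    exit (c , nothing)  = c
    exit (c , just _)   = next c

    -- Half of the scaled potential of hub c under a current at b. The average of two hubs, as seen
    -- at an inner vertex, is then a plain sum of two such values.
    hubPotential : Place → Fin n → ℚ
    hubPotential b c = G c (entry b) + G c (exit b)

    -- A unit current into an inner vertex t raises the total of its copy by 1 / 2 beyond what the
    -- hubs impose. Every inner vertex of the copy thereby gains 1 / (2m), and t itself a further 1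
    -- / m; times 4mn these are 2n and 4n.
    localGreen : Place → Place → ℚ
    localGreen (c , just s) (d , just t) = fromℕ 2 * nℚ * (unit c d * (fromℕ 2 * unit s t + 1ℚ))
    localGreen (_ , nothing) _           = 0ℚ
    localGreen (_ , just _) (_ , nothing) = 0ℚ

    -- The potential produced by a unit current is, at an inner vertex, the average of the
    -- potentials of the two hubs of its copy plus a contribution of the current entering that copy;
    -- on the hubs it is governed by the cycle. Scaling by 4 m n clears all denominators.
    green : Place → Place → ℚ
    green a b = hubPotential b (entry a) + hubPotential b (exit a) + localGreen a b

    localGreen-sym : ∀ a b → localGreen a b ≡ localGreen b a
    localGreen-sym (c , just s)  (d , just t)  =
      cong₂ (λ p q → fromℕ 2 * nℚ * (p * (fromℕ 2 * q + 1ℚ))) (unit-sym c d) (unit-sym s t)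
    localGreen-sym (_ , just _)  (_ , nothing) = refl
    localGreen-sym (_ , nothing) (_ , just _)  = refl
    localGreen-sym (_ , nothing) (_ , nothing) = refl

    green-sym : ∀ a b → green a b ≡ green b a
    green-sym a b = trans
      (lemma (G (entry a) (entry b)) (G (entry a) (exit b)) (G (exit a) (entry b)) (G (exit a) (exit b)) (localGreen a b))
      (cong₂ _+_ (cong₂ _+_ (cong₂ _+_ (cycleGreen-sym (entry a) (entry b)) (cycleGreen-sym (exit a) (entry b)))
                            (cong₂ _+_ (cycleGreen-sym (entry a) (exit b)) (cycleGreen-sym (exit a) (exit b))))
                 (localGreen-sym a b))
      where
      lemma : ∀ p q s t l → (p + q) + (s + t) + l ≡ (p + s) + (q + t) + l
      lemma = solve-∀ ℚ-ring

    Z : Mat N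
    Z u v = green (place u) (place v)

    Z-vertex : ∀ a b → Z (vertex a) (vertex b) ≡ green a b
    Z-vertex a b = cong₂ green (place-vertex a) (place-vertex b)

    localSum : Place → Fin n → ℚ
    localSum (d , nothing) c = 0ℚ
    localSum (d , just t)  c = fromℕ 2 * nℚ * mℚ * unit c d

    ∑-localGreen : ∀ b c → ∑[ s < r ] localGreen (c , just s) b ≡ localSum b c
    ∑-localGreen (d , nothing) c = sum-replicate-zero r
    ∑-localGreen (d , just t)  c = begin
      ∑[ s < r ] (fromℕ 2 * nℚ * (unit c d * (fromℕ 2 * unit s t + 1ℚ)))
        ≡⟨ sum-cong-≗ (λ s → trans (cong (λ e → fromℕ 2 * nℚ * (unit c d * (fromℕ 2 * e + 1ℚ))) (unit-sym s t))
             (lemma₁ nℚ (unit c d) (unit t s))) ⟩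
      ∑[ s < r ] (fromℕ 4 * nℚ * unit c d * unit t s + fromℕ 2 * nℚ * unit c d * 1ℚ)
        ≡⟨ ∑-linear (fromℕ 4 * nℚ * unit c d) (fromℕ 2 * nℚ * unit c d) (unit t) (λ _ → 1ℚ) ⟩
      fromℕ 4 * nℚ * unit c d * ∑[ s < r ] unit t s + fromℕ 2 * nℚ * unit c d * ∑[ s < r ] 1ℚ
        ≡⟨ cong₂ (λ p q → fromℕ 4 * nℚ * unit c d * p + fromℕ 2 * nℚ * unit c d * q) (∑-unit-row t) (∑-const r 1ℚ) ⟩
      fromℕ 4 * nℚ * unit c d * 1ℚ + fromℕ 2 * nℚ * unit c d * (rℚ * 1ℚ)
        ≡⟨ lemma₂ nℚ (unit c d) rℚ ⟩
      fromℕ 2 * nℚ * (fromℕ 2 + rℚ) * unit c d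
        ≡⟨ cong (λ a → fromℕ 2 * nℚ * a * unit c d) mℚ≡ ⟨
      fromℕ 2 * nℚ * mℚ * unit c d ∎
      where
      open ≡-Reasoning
      lemma₁ : ∀ n c s → fromℕ 2 * n * (c * (fromℕ 2 * s + 1ℚ)) ≡ fromℕ 4 * n * c * s + fromℕ 2 * n * c * 1ℚ
      lemma₁ = solve-∀ ℚ-ring
      lemma₂ : ∀ n c r → fromℕ 4 * n * c * 1ℚ + fromℕ 2 * n * c * (r * 1ℚ) ≡ fromℕ 2 * n * (fromℕ 2 + r) * c
      lemma₂ = solve-∀ ℚ-ring

    module Column (b : Place) where
      g : Fin n → ℚ
      g = hubPotential b

      f : Fin N → ℚ
      f u = Z u (vertex b)

      f-hub : ∀ c → f (hub c) ≡ g c + g c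
      f-hub c = trans (Z-vertex (c , nothing) b) (ℚ.+-identityʳ (g c + g c))

      f-petal : ∀ c s → f (petal c s) ≡ g c + g (next c) + localGreen (c , just s) b
      f-petal c s = Z-vertex (c , just s) b

      f-copySum : ∀ c → copySum f c ≡ mℚ * (g c + g (next c)) + localSum b c
      f-copySum c = begin
        copySum f c
          ≡⟨ copySum-expand f c ⟩
        f (hub (next c)) + (f (hub c) + ∑[ s < r ] f (petal c s))
          ≡⟨ cong₂ _+_ (f-hub (next c)) (cong₂ _+_ (f-hub c) (trans (sum-cong-≗ (f-petal c))
               (trans (∑-distrib-+ (λ _ → g c + g (next c)) (λ s → localGreen (c , just s) b))
                      (cong₂ _+_ (∑-const r (g c + g (next c))) (∑-localGreen b c))))) ⟩
        g (next c) + g (next c) + (g c + g c + (rℚ * (g c + g (next c)) + localSum b c))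
          ≡⟨ lemma (g c) (g (next c)) rℚ (localSum b c) ⟩
        (fromℕ 2 + rℚ) * (g c + g (next c)) + localSum b c
          ≡⟨ cong (λ a → a * (g c + g (next c)) + localSum b c) mℚ≡ ⟨
        mℚ * (g c + g (next c)) + localSum b c ∎
        where
        open ≡-Reasoning
        lemma : ∀ p q r l → q + q + (p + p + (r * (p + q) + l)) ≡ (fromℕ 2 + r) * (p + q) + l
        lemma = solve-∀ ℚ-ring

      -- The net current that copy c absorbs at its vertex a under the potential f, in the form that
      -- `laplacian-flower` sums over occurrences.
      current : Fin n → Fin m → ℚ
      current c a = mℚ * f (vertexIn c a) - copySum f c

      -- Hubs have potential 2g, so the first term is the current (m / 2)(f(y) - f(x)) of a resistor
      -- 2 / m. The second is the half, 2mn out of 4mn, of an inner source that leaves the copy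
      -- through this hub.
      current-y : ∀ c → current c y ≡ mℚ * (g (next c) - g c) - localSum b c
      current-y c = trans (cong₂ (λ p q → mℚ * p - q) (trans (cong f (glue-y c)) (f-hub (next c))) (f-copySum c))
                          (lemma mℚ (g c) (g (next c)) (localSum b c))
        where
        lemma : ∀ m p q l → m * (q + q) - (m * (p + q) + l) ≡ m * (q - p) - l
        lemma = solve-∀ ℚ-ring

      current-x : ∀ c → current c x ≡ mℚ * (g c - g (next c)) - localSum b c
      current-x c = trans (cong₂ (λ p q → mℚ * p - q) (trans (cong f (glue-x c)) (f-hub c)) (f-copySum c))
                          (lemma mℚ (g c) (g (next c)) (localSum b c))
        where
        lemma : ∀ m p q l → m * (p + p) - (m * (p + q) + l) ≡ m * (p - q) - l
        lemma = solve-∀ ℚ-ring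

      current-inner : ∀ c s → current c (inner s) ≡ mℚ * localGreen (c , just s) b - localSum b c
      current-inner c s = trans (cong₂ (λ p q → mℚ * p - q) (trans (cong f (glue-inner c s)) (f-petal c s)) (f-copySum c))
                                (lemma mℚ (g c + g (next c)) (localGreen (c , just s) b) (localSum b c))
        where
        lemma : ∀ m p l k → m * (p + l) - (m * p + k) ≡ m * l - k
        lemma = solve-∀ ℚ-ring

      -- The currents of the two copies that meet at hub i combine to a second difference along the
      -- cycle, once for the half source at `entry b` and once for that at `exit b`;
      -- `cycleGreen-laplacian` evaluates both.
      hub-current : ∀ i → incidence (hub i) current ≡
        mℚ * (fromℕ 2 * nℚ * (unit i (entry b) + unit i (exit b)) - fromℕ 4) - (localSum b (prev i) + localSum b i)
      hub-current i = begin
        incidence (hub i) current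
          ≡⟨ incidence-hub i current ⟩
        current (prev i) y + current i x
          ≡⟨ cong₂ _+_ (trans (current-y (prev i))
               (cong (λ k → mℚ * (g k - g (prev i)) - localSum b (prev i)) (next-prev i))) (current-x i) ⟩
        (mℚ * (g i - g (prev i)) - localSum b (prev i)) + (mℚ * (g i - g (next i)) - localSum b i)
          ≡⟨ lemma₁ mℚ (G i (entry b)) (G i (exit b)) (G (prev i) (entry b)) (G (prev i) (exit b))
               (G (next i) (entry b)) (G (next i) (exit b))
               (localSum b (prev i)) (localSum b i) ⟩
        mℚ * (((G i (entry b) - G (next i) (entry b)) - (G (prev i) (entry b) - G i (entry b))) +
              ((G i (exit b) - G (next i) (exit b)) - (G (prev i) (exit b) - G i (exit b)))) - (localSum b (prev i) + localSum b i)
          ≡⟨ cong₂ (λ p q → mℚ * (p + q) - (localSum b (prev i) + localSum b i))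
               (cycleGreen-laplacian i (entry b)) (cycleGreen-laplacian i (exit b)) ⟩
        mℚ * ((fromℕ 2 * nℚ * unit i (entry b) - fromℕ 2) + (fromℕ 2 * nℚ * unit i (exit b) - fromℕ 2)) - (localSum b (prev i) + localSum b i)
          ≡⟨ lemma₂ mℚ nℚ (unit i (entry b)) (unit i (exit b)) (localSum b (prev i) + localSum b i) ⟩
        mℚ * (fromℕ 2 * nℚ * (unit i (entry b) + unit i (exit b)) - fromℕ 4) - (localSum b (prev i) + localSum b i) ∎
        where
        open ≡-Reasoning
        lemma₁ : ∀ m p p′ q q′ s s′ k l → (m * ((p + p′) - (q + q′)) - k) + (m * ((p + p′) - (s + s′)) - l) ≡
                 m * (((p - s) - (q - p)) + ((p′ - s′) - (q′ - p′))) - (k + l)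
        lemma₁ = solve-∀ ℚ-ring
        lemma₂ : ∀ m n u v k → m * ((fromℕ 2 * n * u - fromℕ 2) + (fromℕ 2 * n * v - fromℕ 2)) - k ≡
                 m * (fromℕ 2 * n * (u + v) - fromℕ 4) - k
        lemma₂ = solve-∀ ℚ-ring

    scale : ℕ
    scale = 4 ℕ.* (m ℕ.* n)

    scale-ℚ : fromℕ scale ≡ fromℕ 4 * (mℚ * nℚ)
    scale-ℚ = trans (fromℕ-* 4 (m ℕ.* n)) (cong (fromℕ 4 *_) (fromℕ-* m n))

    -- The drain w: a source of strength 4mn is withdrawn evenly, 4m at each of the n hubs, wherever
    -- the source lies.
    excess : Place → ℚ
    excess (_ , nothing) = fromℕ 4 * mℚ
    excess (_ , just _)  = 0ℚ

    green-current : ∀ a b → incidence (vertex a) (Column.current b) ≡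
                    fromℕ 4 * (mℚ * nℚ) * unit (vertex a) (vertex b) - excess a
    green-current (i , nothing) b@(j , nothing) = trans (Column.hub-current b i)
      (trans (lemma mℚ nℚ (unit i j)) (cong (λ e → fromℕ 4 * (mℚ * nℚ) * e - fromℕ 4 * mℚ)
          (sym (trans (unit-hub-hub i j) (unit-sym j i)))))
      where
      lemma : ∀ m n u → m * (fromℕ 2 * n * (u + u) - fromℕ 4) - (0ℚ + 0ℚ) ≡ fromℕ 4 * (m * n) * u - fromℕ 4 * m
      lemma = solve-∀ ℚ-ring
    -- The cycle demands 2mn at each of the hubs j and `next j`. This is exactly what the inner
    -- source delivers there through `localSum`, so the two cancel and only the drain is left.
    green-current (i , nothing) b@(j , just t) = trans (Column.hub-current b i)
      (trans (cong (λ e → mℚ * (fromℕ 2 * nℚ * (unit i j + unit i (next j)) - fromℕ 4) -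
                       (fromℕ 2 * nℚ * mℚ * e + fromℕ 2 * nℚ * mℚ * unit i j)) (unit-prev i j))
        (trans (lemma mℚ nℚ (unit i j) (unit i (next j))) (cong (λ e → fromℕ 4 * (mℚ * nℚ) * e - fromℕ 4 * mℚ)
            (sym (unit-hub-petal i j t)))))
      where
      lemma : ∀ m n u v → m * (fromℕ 2 * n * (u + v) - fromℕ 4) - (fromℕ 2 * n * m * v + fromℕ 2 * n * m * u) ≡
          fromℕ 4 * (m * n) * 0ℚ - fromℕ 4 * m
      lemma = solve-∀ ℚ-ring
    green-current (i , just s) b@(j , nothing) = trans (incidence-petal i s (Column.current b)) (trans (Column.current-inner b i s)
      (trans (lemma mℚ nℚ) (cong (λ e → fromℕ 4 * (mℚ * nℚ) * e - 0ℚ) (sym (unit-petal-hub i s j)))))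
      where
      lemma : ∀ m n → m * 0ℚ - 0ℚ ≡ fromℕ 4 * (m * n) * 0ℚ - 0ℚ
      lemma = solve-∀ ℚ-ring
    green-current (i , just s) b@(j , just t) = trans (incidence-petal i s (Column.current b)) (trans (Column.current-inner b i s)
      (trans (lemma mℚ nℚ (unit i j) (unit s t)) (cong (λ e → fromℕ 4 * (mℚ * nℚ) * e - 0ℚ)
        (sym (trans (unit-petal-petal i s j t) (cong₂ _*_ (unit-sym j i) (unit-sym t s)))))))
      where
      lemma : ∀ m n u v → m * (fromℕ 2 * n * (u * (fromℕ 2 * v + 1ℚ))) - fromℕ 2 * n * m * u ≡ fromℕ 4 * (m * n) * (u * v) - 0ℚ
      lemma = solve-∀ ℚ-ring

    laplacian⊗Z : ∀ u v → (laplacian F ⊗ Z) u v ≡ fromℕ scale * unit u v - excess (place u)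
    laplacian⊗Z u v = subst₂ (λ u′ v′ → (laplacian F ⊗ Z) u′ v′ ≡ fromℕ scale * unit u′ v′ - excess (place u))
      (vertex-place u) (vertex-place v)
      (trans (laplacian-flower (vertex (place u)) (Column.f (place v)))
        (trans (green-current (place u) (place v))
               (cong (λ a → a * unit (vertex (place u)) (vertex (place v)) - excess (place u)) (sym scale-ℚ))))

  -- Degree-weighted sums of the Green matrix and the value of Kemeny's constant.

  module FlowerKemeny {n′ r : ℕ} (3≤n : 3 ℕ.≤ suc n′) {x y : Fin (suc (suc r))} (x≢y : x ≢ y) where

    open Flower 3≤n x≢y
    open FlowerGreen 3≤n x≢y

    private
      nℚ mℚ rℚ k : ℚ
      nℚ = fromℕ n
      mℚ = fromℕ m
      rℚ = fromℕ r
      k = mℚ - 1ℚ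

      d : Fin N → ℚ
      d u = fromℕ (degree F u)

      G : Fin n → Fin n → ℚ
      G = cycleGreen n

    ∑-copySum : (f : Fin N → ℚ) → ∑[ c < n ] copySum f c ≡ fromℕ 2 * ∑[ c < n ] f (hub c) + ∑[ c < n ] ∑[ s < r ] f (petal c s)
    ∑-copySum f = begin
      ∑[ c < n ] copySum f c
        ≡⟨ sum-cong-≗ (copySum-expand f) ⟩
      ∑[ c < n ] (h (next c) + (h c + p c))
        ≡⟨ trans (∑-distrib-+ (h ∘ next) (λ c → h c + p c)) (cong₂ _+_ (∑-next h) (∑-distrib-+ h p)) ⟩
      sum h + (sum h + sum p)
        ≡⟨ lemma (sum h) (sum p) ⟩
      fromℕ 2 * sum h + sum p ∎
      where
      open ≡-Reasoning
      h p : Fin n → ℚ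
      h c = f (hub c)
      p c = ∑[ s < r ] f (petal c s)
      lemma : ∀ h p → h + (h + p) ≡ fromℕ 2 * h + p
      lemma = solve-∀ ℚ-ring

    ∑-degree-hubs : (f : Fin N → ℚ) (h p : Fin n → ℚ) → (∀ c → f (hub c) ≡ h c) → (∀ c s → f (petal c s) ≡ p c) →
                    ∑[ u < N ] (d u * f u) ≡ k * (fromℕ 2 * sum h + rℚ * sum p)
    ∑-degree-hubs f h p at-hub at-petal = begin
      ∑[ u < N ] (d u * f u)
        ≡⟨ ∑-degree f ⟩
      k * ∑[ c < n ] copySum f c
        ≡⟨ cong (k *_) (∑-copySum f) ⟩
      k * (fromℕ 2 * ∑[ c < n ] f (hub c) + ∑[ c < n ] ∑[ s < r ] f (petal c s))
        ≡⟨ cong₂ (λ a b → k * (fromℕ 2 * a + b)) ∑-hubs ∑-petals ⟩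
      k * (fromℕ 2 * sum h + rℚ * sum p) ∎
      where
      open ≡-Reasoning
      ∑-hubs : ∑[ c < n ] f (hub c) ≡ sum h
      ∑-hubs = sum-cong-≗ at-hub
      ∑-petals : ∑[ c < n ] ∑[ s < r ] f (petal c s) ≡ rℚ * sum p
      ∑-petals = begin
        ∑[ c < n ] ∑[ s < r ] f (petal c s)   ≡⟨ sum-cong-≗ (λ c → sum-cong-≗ (at-petal c)) ⟩
        ∑[ c < n ] ∑[ s < r ] p c             ≡⟨ sum-cong-≗ (λ c → ∑-const r (p c)) ⟩
        ∑[ c < n ] (rℚ * p c)                 ≡⟨ *-distribˡ-sum rℚ p ⟨
        rℚ * sum p                            ∎

    ∑-degrees : ∑[ u < N ] d u ≡ k * (nℚ * mℚ)
    ∑-degrees = begin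
      ∑[ u < N ] d u                            ≡⟨ sum-cong-≗ (λ u → sym (ℚ.*-identityʳ (d u))) ⟩
      ∑[ u < N ] (d u * 1ℚ)                     ≡⟨ ∑-degree (λ _ → 1ℚ) ⟩
      k * ∑[ c < n ] ∑[ a < m ] 1ℚ              ≡⟨ cong (k *_) (sum-cong-≗ {n} (λ _ → trans (∑-const m 1ℚ) (ℚ.*-identityʳ mℚ))) ⟩
      k * ∑[ c < n ] mℚ                         ≡⟨ cong (k *_) (∑-const n mℚ) ⟩
      k * (nℚ * mℚ)                             ∎
      where open ≡-Reasoning

    ∑-degree-diagonal : ∑[ u < N ] (d u * Z u u) ≡ k * (nℚ * rℚ * (fromℕ 2 + fromℕ 4 * nℚ))
    ∑-degree-diagonal = begin
      ∑[ u < N ] (d u * Z u u)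
        ≡⟨ ∑-degree-hubs (λ u → Z u u) (λ _ → 0ℚ) (λ _ → fromℕ 2 + fromℕ 4 * nℚ) at-hub at-petal ⟩
      k * (fromℕ 2 * ∑[ c < n ] 0ℚ + rℚ * ∑[ c < n ] (fromℕ 2 + fromℕ 4 * nℚ))
        ≡⟨ cong₂ (λ a b → k * (fromℕ 2 * a + rℚ * b)) (sum-replicate-zero n) (∑-const n (fromℕ 2 + fromℕ 4 * nℚ)) ⟩
      k * (fromℕ 2 * 0ℚ + rℚ * (nℚ * (fromℕ 2 + fromℕ 4 * nℚ)))
        ≡⟨ lemma k rℚ nℚ ⟩
      k * (nℚ * rℚ * (fromℕ 2 + fromℕ 4 * nℚ)) ∎
      where
      open ≡-Reasoning
      lemma : ∀ k r n → k * (fromℕ 2 * 0ℚ + r * (n * (fromℕ 2 + fromℕ 4 * n))) ≡ k * (n * r * (fromℕ 2 + fromℕ 4 * n))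
      lemma = solve-∀ ℚ-ring
      at-hub : ∀ c → Z (hub c) (hub c) ≡ 0ℚ
      at-hub c = trans (Z-vertex (c , nothing) (c , nothing))
        (cong (λ e → e + e + (e + e) + 0ℚ) (cycleGreen-diagonal c))
      lemma₂ : ∀ n → (0ℚ + (1ℚ - n)) + ((1ℚ - n) + 0ℚ) + fromℕ 2 * n * (1ℚ * (fromℕ 2 * 1ℚ + 1ℚ)) ≡ fromℕ 2 + fromℕ 4 * n
      lemma₂ = solve-∀ ℚ-ring
      unit-diagonal : ∀ {k} (i : Fin k) → unit i i ≡ 1ℚ
      unit-diagonal i = cong fromℕ (𝟙-yes (i ≟ i) refl)
      -- The four pairs of hubs of the copy contribute 0, 1 - n, 1 - n and 0, and the local term is
      -- 2n times 3.
      at-petal : ∀ c s → Z (petal c s) (petal c s) ≡ fromℕ 2 + fromℕ 4 * nℚ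
      at-petal c s = trans (Z-vertex (c , just s) (c , just s)) (trans
        (cong₂ _+_ (cong₂ _+_ (cong₂ _+_ (cycleGreen-diagonal c) (cycleGreen-next c))
                              (cong₂ _+_ (trans (cycleGreen-sym (next c) c) (cycleGreen-next c)) (cycleGreen-diagonal (next c))))
                   (cong₂ (λ u v → fromℕ 2 * nℚ * (u * (fromℕ 2 * v + 1ℚ))) (unit-diagonal c) (unit-diagonal s)))
        (lemma₂ nℚ))

    private
      column : Fin n → ℚ
      column j = ∑[ c < n ] G c j

    ∑-degree-column : ∀ b → ∑[ u < N ] (d u * Z u (vertex b)) ≡
                      k * (fromℕ 2 * mℚ * (column (entry b) + column (exit b)) + sum (localSum b))
    ∑-degree-column b = begin
      ∑[ u < N ] (d u * f u)
        ≡⟨ ∑-degree f ⟩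
      k * ∑[ c < n ] copySum f c
        ≡⟨ cong (k *_) (trans (sum-cong-≗ f-copySum) (∑-distrib-+ (λ c → mℚ * (g c + g (next c))) (localSum b))) ⟩
      k * (∑[ c < n ] (mℚ * (g c + g (next c))) + sum (localSum b))
        ≡⟨ cong (λ a → k * (a + sum (localSum b))) (trans (sym (*-distribˡ-sum mℚ (λ c → g c + g (next c))))
             (cong (mℚ *_) (trans (∑-distrib-+ g (g ∘ next)) (cong (sum g +_) (∑-next g))))) ⟩
      k * (mℚ * (sum g + sum g) + sum (localSum b))
        ≡⟨ cong (λ a → k * (mℚ * (a + a) + sum (localSum b))) (∑-distrib-+ (λ c → G c (entry b)) (λ c → G c (exit b))) ⟩
      k * (mℚ * ((column (entry b) + column (exit b)) + (column (entry b) + column (exit b))) + sum (localSum b))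
        ≡⟨ lemma k mℚ (column (entry b) + column (exit b)) (sum (localSum b)) ⟩
      k * (fromℕ 2 * mℚ * (column (entry b) + column (exit b)) + sum (localSum b)) ∎
      where
      open ≡-Reasoning
      open Column b
      lemma : ∀ k m s l → k * (m * (s + s) + l) ≡ k * (fromℕ 2 * m * s + l)
      lemma = solve-∀ ℚ-ring

    ∑-localSum-petal : ∀ j t → sum (localSum (j , just t)) ≡ fromℕ 2 * nℚ * mℚ
    ∑-localSum-petal j t = begin
      ∑[ c < n ] (fromℕ 2 * nℚ * mℚ * unit c j)   ≡⟨ *-distribˡ-sum (fromℕ 2 * nℚ * mℚ) (λ c → unit c j) ⟨
      fromℕ 2 * nℚ * mℚ * ∑[ c < n ] unit c j     ≡⟨ cong (fromℕ 2 * nℚ * mℚ *_)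
          (trans (sum-cong-≗ (λ c → unit-sym c j)) (∑-unit-row j)) ⟩
      fromℕ 2 * nℚ * mℚ * 1ℚ                      ≡⟨ ℚ.*-identityʳ (fromℕ 2 * nℚ * mℚ) ⟩
      fromℕ 2 * nℚ * mℚ                           ∎
      where open ≡-Reasoning

    -- The inner sum depends on v only through its copy and on whether v is a hub, so the outer sum
    -- reduces to sums over copies. There `∑-next` absorbs the shift from entry to exit, and only
    -- the total of `column` remains.
    ∑∑-degree : ∑[ v < N ] (d v * ∑[ u < N ] (d u * Z u v)) ≡
                k * k * (fromℕ 4 * mℚ * (fromℕ 2 + rℚ) * sum column + fromℕ 2 * rℚ * nℚ * nℚ * mℚ)
    ∑∑-degree = begin
      ∑[ v < N ] (d v * ∑[ u < N ] (d u * Z u v))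
        ≡⟨ ∑-degree-hubs (λ v → ∑[ u < N ] (d u * Z u v)) h p at-hub at-petal ⟩
      k * (fromℕ 2 * sum h + rℚ * sum p)
        ≡⟨ cong₂ (λ a b → k * (fromℕ 2 * a + rℚ * b)) (sym (*-distribˡ-sum (k * (fromℕ 4 * mℚ)) column)) ∑p ⟩
      k * (fromℕ 2 * (k * (fromℕ 4 * mℚ) * sum column) + rℚ * (k * (fromℕ 2 * mℚ * (sum column + sum column) + nℚ * (fromℕ 2 * nℚ * mℚ))))
        ≡⟨ lemma k mℚ nℚ rℚ (sum column) ⟩
      k * k * (fromℕ 4 * mℚ * (fromℕ 2 + rℚ) * sum column + fromℕ 2 * rℚ * nℚ * nℚ * mℚ) ∎
      where
      open ≡-Reasoning
      h p : Fin n → ℚ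
      h j = k * (fromℕ 4 * mℚ) * column j
      p j = k * (fromℕ 2 * mℚ * (column j + column (next j)) + fromℕ 2 * nℚ * mℚ)
      lemma-hub : ∀ k m y → k * (fromℕ 2 * m * (y + y) + 0ℚ) ≡ k * (fromℕ 4 * m) * y
      lemma-hub = solve-∀ ℚ-ring
      at-hub : ∀ j → ∑[ u < N ] (d u * Z u (hub j)) ≡ h j
      at-hub j = trans (∑-degree-column (j , nothing))
        (trans (cong (λ a → k * (fromℕ 2 * mℚ * (column j + column j) + a)) (sum-replicate-zero n)) (lemma-hub k mℚ (column j)))
      at-petal : ∀ j t → ∑[ u < N ] (d u * Z u (petal j t)) ≡ p j
      at-petal j t = trans (∑-degree-column (j , just t))
        (cong (λ a → k * (fromℕ 2 * mℚ * (column j + column (next j)) + a)) (∑-localSum-petal j t))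
      ∑p : sum p ≡ k * (fromℕ 2 * mℚ * (sum column + sum column) + nℚ * (fromℕ 2 * nℚ * mℚ))
      ∑p = begin
        sum p
          ≡⟨ *-distribˡ-sum k (λ j → fromℕ 2 * mℚ * (column j + column (next j)) + fromℕ 2 * nℚ * mℚ) ⟨
        k * ∑[ j < n ] (fromℕ 2 * mℚ * (column j + column (next j)) + fromℕ 2 * nℚ * mℚ)
          ≡⟨ cong (k *_) (trans (∑-distrib-+ (λ j → fromℕ 2 * mℚ * (column j + column (next j))) (λ _ → fromℕ 2 * nℚ * mℚ))
               (cong₂ _+_ (trans (sym (*-distribˡ-sum (fromℕ 2 * mℚ) (λ j → column j + column (next j))))
                            (cong (fromℕ 2 * mℚ *_) (trans (∑-distrib-+ column (column ∘ next))
                                  (cong (sum column +_) (∑-next column)))))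
                          (∑-const n (fromℕ 2 * nℚ * mℚ)))) ⟩
        k * (fromℕ 2 * mℚ * (sum column + sum column) + nℚ * (fromℕ 2 * nℚ * mℚ)) ∎
      lemma : ∀ k m n r y →
        k * (fromℕ 2 * (k * (fromℕ 4 * m) * y) + r * (k * (fromℕ 2 * m * (y + y) + n * (fromℕ 2 * n * m)))) ≡
        k * k * (fromℕ 4 * m * (fromℕ 2 + r) * y + fromℕ 2 * r * n * n * m)
      lemma = solve-∀ ℚ-ring

    ∑-column : fromℕ 6 * sum column ≡ ℚ.- (nℚ * nℚ * (nℚ * nℚ - 1ℚ))
    ∑-column = trans (cong (fromℕ 6 *_) (∑-comm (λ j c → G c j))) (∑∑-cycleGreen n)

    open Centring (laplacian F) Z (λ u → excess (place u)) scale (laplacian-sym F) (laplacian-rows F)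
      (λ u v → green-sym (place v) (place u)) laplacian⊗Z public

    edgeCount-ℚ : fromℕ (edgeCount F ℕ.+ edgeCount F) ≡ k * (nℚ * mℚ)
    edgeCount-ℚ = trans (cong fromℕ (handshake F)) (trans (∑-fromℕ (degree F)) ∑-degrees)

    -- In ℕ the right side computes to a successor, so a vanishing edge count is refuted by pattern
    -- matching; this makes the reciprocal in the definition of the constant meaningful.
    edgeCount-ℕ : edgeCount F ℕ.+ edgeCount F ≡ suc r ℕ.* (n ℕ.* m)
    edgeCount-ℕ = fromℕ-injective (trans edgeCount-ℚ (trans
      (cong₂ _*_ (trans (cong (_- 1ℚ) (fromℕ-suc (suc r))) (lemma (fromℕ (suc r)))) (sym (fromℕ-* n m)))
      (sym (fromℕ-* (suc r) (n ℕ.* m)))))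
      where
      lemma : ∀ a → 1ℚ + a - 1ℚ ≡ a
      lemma = solve-∀ ℚ-ring
      fromℕ-injective : ∀ {a b} → fromℕ a ≡ fromℕ b → a ≡ b
      fromℕ-injective {a} {b} eq = trans (sym (ℕ.*-identityʳ a)) (trans (ℚ.normalize-injective-≃ a b 1 1 eq) (ℕ.*-identityʳ b))

    4∣E∣≢0 : NonZero (4 ℕ.* edgeCount F)
    4∣E∣≢0 = positive (edgeCount F) edgeCount-ℕ
      where
      positive : ∀ e → e ℕ.+ e ≡ suc r ℕ.* (n ℕ.* m) → NonZero (4 ℕ.* e)
      positive zero    ()
      positive (suc _) _ = _

    fromℕ-4∣E∣ : fromℕ (4 ℕ.* edgeCount F) ≡ fromℕ 2 * (k * (nℚ * mℚ))
    fromℕ-4∣E∣ = begin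
      fromℕ (4 ℕ.* e)                  ≡⟨ fromℕ-* 4 e ⟩
      fromℕ 4 * fromℕ e                ≡⟨ lemma (fromℕ e) ⟩
      fromℕ 2 * (fromℕ e + fromℕ e)    ≡⟨ cong (fromℕ 2 *_) (trans (sym (fromℕ-+ e e)) edgeCount-ℚ) ⟩
      fromℕ 2 * (k * (nℚ * mℚ))        ∎
      where
      open ≡-Reasoning
      e = edgeCount F
      lemma : ∀ e → fromℕ 4 * e ≡ fromℕ 2 * (e + e)
      lemma = solve-∀ ℚ-ring

    -- The factor 6m clears the denominator of the claimed value, and its 6 is the one demanded by
    -- `∑-column`. After regrouping, the two reciprocals meet 4∣E∣ and 4mn and vanish.
    kemeny-6m : (recip (4 ℕ.* edgeCount F) {{4∣E∣≢0}} * weightedResistanceSum F pinv) * fromℕ (6 ℕ.* m) ≡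
                k * (fromℕ 6 * rℚ * nℚ + mℚ * (nℚ * nℚ - 1ℚ))
    kemeny-6m = begin
      (η * weightedResistanceSum F pinv) * fromℕ (6 ℕ.* m)
        ≡⟨ cong₂ (λ a b → η * a * b) (weightedResistanceSum-pinv F) (fromℕ-* 6 m) ⟩
      (η * (fromℕ 2 * ι * (sum d * T - Q))) * (fromℕ 6 * mℚ)
        ≡⟨ cong (λ a → (η * (fromℕ 2 * ι * a)) * (fromℕ 6 * mℚ)) (cong₂ _-_ (cong₂ _*_ ∑-degrees ∑-degree-diagonal)
             (trans ∑∑-degree (cong (λ a → k * k * (fromℕ 4 * mℚ * a * sum column + fromℕ 2 * rℚ * nℚ * nℚ * mℚ))
                    (sym (fromℕ-+ 2 r))))) ⟩
      (η * (fromℕ 2 * ι * (k * (nℚ * mℚ) * (k * (nℚ * rℚ * (fromℕ 2 + fromℕ 4 * nℚ))) -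
                           k * k * (fromℕ 4 * mℚ * mℚ * sum column + fromℕ 2 * rℚ * nℚ * nℚ * mℚ)))) * (fromℕ 6 * mℚ)
        -- The 2 in the diagonal value 2 + 4n cancels against the local part of the double sum, so
        -- only its 4n and the cycle total survive.
        ≡⟨ lemma₁ η ι k mℚ nℚ rℚ (sum column) ⟩
      (η * fromℕ 2 * ι * mℚ * k * k) * (fromℕ 24 * rℚ * mℚ * nℚ * nℚ * nℚ - fromℕ 4 * mℚ * mℚ * (fromℕ 6 * sum column))
        ≡⟨ cong (λ a → (η * fromℕ 2 * ι * mℚ * k * k) * (fromℕ 24 * rℚ * mℚ * nℚ * nℚ * nℚ - fromℕ 4 * mℚ * mℚ * a)) ∑-column ⟩
      (η * fromℕ 2 * ι * mℚ * k * k) * (fromℕ 24 * rℚ * mℚ * nℚ * nℚ * nℚ - fromℕ 4 * mℚ * mℚ * (ℚ.- (nℚ * nℚ * (nℚ * nℚ - 1ℚ))))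
        ≡⟨ lemma₂ η ι k mℚ nℚ rℚ ⟩
      (η * (fromℕ 2 * (k * (nℚ * mℚ)))) * (ι * (fromℕ 4 * (mℚ * nℚ))) * (k * (fromℕ 6 * rℚ * nℚ + mℚ * (nℚ * nℚ - 1ℚ)))
        ≡⟨ cong₂ (λ a b → a * b * (k * (fromℕ 6 * rℚ * nℚ + mℚ * (nℚ * nℚ - 1ℚ))))
             (trans (cong (η *_) (sym fromℕ-4∣E∣)) (recip-inverse (4 ℕ.* edgeCount F) {{4∣E∣≢0}}))
             (trans (cong (ι *_) (sym scale-ℚ)) (recip-inverse scale)) ⟩
      1ℚ * 1ℚ * (k * (fromℕ 6 * rℚ * nℚ + mℚ * (nℚ * nℚ - 1ℚ)))
        ≡⟨ ℚ.*-identityˡ _ ⟩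
      k * (fromℕ 6 * rℚ * nℚ + mℚ * (nℚ * nℚ - 1ℚ)) ∎
      where
      open ≡-Reasoning
      η = recip (4 ℕ.* edgeCount F) {{4∣E∣≢0}}
      ι = recip scale
      T = ∑[ u < N ] (d u * Z u u)
      Q = ∑[ v < N ] (d v * ∑[ u < N ] (d u * Z u v))
      lemma₁ : ∀ e i k m n r y →
        (e * (fromℕ 2 * i * (k * (n * m) * (k * (n * r * (fromℕ 2 + fromℕ 4 * n))) -
                             k * k * (fromℕ 4 * m * m * y + fromℕ 2 * r * n * n * m)))) * (fromℕ 6 * m) ≡
        (e * fromℕ 2 * i * m * k * k) * (fromℕ 24 * r * m * n * n * n - fromℕ 4 * m * m * (fromℕ 6 * y))
      lemma₁ = solve-∀ ℚ-ring
      lemma₂ : ∀ e i k m n r →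
        (e * fromℕ 2 * i * m * k * k) * (fromℕ 24 * r * m * n * n * n - fromℕ 4 * m * m * (ℚ.- (n * n * (n * n - 1ℚ)))) ≡
        (e * (fromℕ 2 * (k * (n * m)))) * (i * (fromℕ 4 * (m * n))) * (k * (fromℕ 6 * r * n + m * (n * n - 1ℚ)))
      lemma₂ = solve-∀ ℚ-ring

    isKemenyConstant : IsKemenyConstant F (kemenyNumerator (ℤ.+ m) (ℤ.+ n) ℚ./ (6 ℕ.* m))
    isKemenyConstant = record
      { connected       = connected
      ; 4∣E∣≢0          = 4∣E∣≢0
      ; L†              = pinv
      ; isPseudoinverse = isPseudoinverse
      ; value           = *-fromℕ-cancelʳ (6 ℕ.* m) (begin
          (kemenyNumerator (ℤ.+ m) (ℤ.+ n) ℚ./ (6 ℕ.* m)) * fromℕ (6 ℕ.* m)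
            ≡⟨ /-*-cancel (kemenyNumerator (ℤ.+ m) (ℤ.+ n)) (6 ℕ.* m) ⟩
          fromℤ (kemenyNumerator (ℤ.+ m) (ℤ.+ n))
            ≡⟨ fromℤ-kemenyNumerator (ℤ.+ m) (ℤ.+ n) ⟩
          k * (fromℕ 6 * (mℚ - fromℕ 2) * nℚ + mℚ * (nℚ * nℚ - 1ℚ))
            ≡⟨ cong (λ a → k * (fromℕ 6 * a * nℚ + mℚ * (nℚ * nℚ - 1ℚ)))
                 (trans (cong (_- fromℕ 2) (fromℕ-+ 2 r)) (lemma rℚ)) ⟩
          k * (fromℕ 6 * rℚ * nℚ + mℚ * (nℚ * nℚ - 1ℚ))
            ≡⟨ kemeny-6m ⟨
          (recip (4 ℕ.* edgeCount F) {{4∣E∣≢0}} * weightedResistanceSum F pinv) * fromℕ (6 ℕ.* m) ∎)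
      }
      where
      open ≡-Reasoning
      lemma : ∀ a → fromℕ 2 + a - fromℕ 2 ≡ a
      lemma = solve-∀ ℚ-ring

open import Data.Fin.Base using (Fin)
open import Data.Integer.Base using (+_; -_; _+_; _-_; _*_; _^_)
open import Data.Nat.Base as ℕ using (ℕ)
open import Data.Rational.Base using (_/_)
open import Relation.Binary.PropositionalEquality using (_≢_)

theorem4p6 : ∀ (m n : ℕ) (3≤m : 3 ℕ.≤ m) (3≤n : 3 ℕ.≤ n) (x y : Fin m) (x≢y : x ≢ y) →
    IsKemenyConstant (flower 3≤n (complete m) x≢y)
    ((((+ m - + 1) * (- + 12 * + n + + m * ((+ n) ^ 2 + + 6 * + n - + 1))) / (6 ℕ.* m)) {{6m≢0 3≤m}})
theorem4p6 (ℕ.suc (ℕ.suc _)) (ℕ.suc _) _            3≤n _ _ x≢y = KemenyOfFlower.FlowerKemeny.isKemenyConstant 3≤n x≢y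
theorem4p6 (ℕ.suc ℕ.zero)    (ℕ.suc _) (ℕ.s≤s ()) _   _ _ _
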